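{- For every integer $n\geq 3$, \begin{align*} CP_{(4,0)}(n)=&\frac{1+q^{2n-4}+q^{2n-3}+q^{2n-2}}{(1-q^{2n-1})(1-q^{2n})}CP_{(4,0)}(n-1) -\frac{q^{4n-7}+q^{4n-8}+q^{4n-9}}{(1-q^{2n-3})(1-q^{2n-2})(1-q^{2n-1})(1-q^{2n})}CP_{(4,0)}(n-2)\\ &-\frac{q^{4n-10}}{(1-q^{2n-4})(1-q^{2n-3})(1-q^{2n-2})(1-q^{2n-1})(1-q^{2n})}CP_{(4,0)}(n-3). \end{align*}
   Context: A cylindric partition with profile $(c_1,c_2)$ is a pair of partitions $(\lambda^{(1)},\lambda^{(2)})$ (parts in weakly decreasing order, $\lambda^{(i)}_j=0$ beyond the number of parts) with $\lambda^{(1)}_j\ge\lambda^{(2)}_{j+c_2}$ and $\lambda^{(2)}_j\ge\lambda^{(1)}_{j+c_1}$ for all $j\ge1$; its size is $|\lambda^{(1)}|+|\lambda^{(2)}|$. $CP_{(4,0)}(n)$ is the generating function $\sum q^{\text{size}}$ over cylindric partitions of profile $(4,0)$ in which each partition has at most $n$ parts, with $CP_{(4,0)}(0)=1$. -}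

module Defs where

open import Data.Nat as ℕ using (ℕ; zero; suc; _+_; _∸_; _≤ᵇ_; _≡ᵇ_)
open import Data.Nat.Divisibility using (_∣?_)
open import Data.Integer as ℤ using (ℤ; +_)
open import Data.Bool using (Bool; true; false; _∧_; if_then_else_)
open import Data.List using (List; []; _∷_; [_]; map; concatMap; upTo; filter; length; foldr)
open import Data.Vec using (Vec; []; _∷_)
open import Relation.Nullary.Decidable using (does)
open import Relation.Binary.PropositionalEquality using (_≡_)

-- Formal power series in q with integer coefficients: m ↦ [q^m] f

FPS : Set
FPS = ℕ → ℤ

_≈ₛ_ : FPS → FPS → Set
f ≈ₛ g = ∀ m → f m ≡ g m
infix 4 _≈ₛ_

_⊕_ : FPS → FPS → FPS
(f ⊕ g) m = f m ℤ.+ g m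

_⊖_ : FPS → FPS → FPS
(f ⊖ g) m = f m ℤ.- g m

infixl 6 _⊕_ _⊖_

_⊛_ : FPS → FPS → FPS
(f ⊛ g) m = foldr ℤ._+_ (+ 0) (map (λ i → f i ℤ.* g (m ∸ i)) (upTo (suc m)))

infixl 7 _⊛_

q^ : ℕ → FPS
q^ k m = if k ≡ᵇ m then + 1 else + 0

𝟙 : FPS
𝟙 = q^ 0

-- 1 / (1 - q^k) = Σ_{j ≥ 0} q^{k j}, the inverse of 1 - q^k (used for k ≥ 1)
inv1-q^ : ℕ → FPS
inv1-q^ k m = if does (k ∣? m) then + 1 else + 0

-- Partitions with at most n parts are encoded as vectors of length n
-- (weakly decreasing, padded by zeros).  `at v j` is the (j+1)-st part
-- (0-indexed), and 0 beyond the n-th part.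

at : ∀ {n} → Vec ℕ n → ℕ → ℕ
at []       _       = 0
at (x ∷ v)  zero    = x
at (x ∷ v)  (suc j) = at v j

vsum : ∀ {n} → Vec ℕ n → ℕ
vsum []      = 0
vsum (x ∷ v) = x + vsum v

allBelow : ℕ → (ℕ → Bool) → Bool
allBelow n p = foldr _∧_ true (map p (upTo n))

isPartition : ∀ {n} → Vec ℕ n → Bool
isPartition {n} v = allBelow n (λ j → at v (suc j) ≤ᵇ at v j)

-- cylindric condition for profile (c₁,c₂):
--   λ¹_j ≥ λ²_{j+c₂} and λ²_j ≥ λ¹_{j+c₁} for all j ≥ 1.
-- For j beyond n both left-hand sides and right-hand sides vanish,
-- so it suffices to check j < n (0-indexed).
isCylindric : ℕ → ℕ → ∀ {n} → Vec ℕ n → Vec ℕ n → Bool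
isCylindric c₁ c₂ {n} l₁ l₂ =
  isPartition l₁ ∧ isPartition l₂ ∧
  allBelow n (λ j → (at l₂ (j + c₂) ≤ᵇ at l₁ j) ∧ (at l₁ (j + c₁) ≤ᵇ at l₂ j))

allVecs : (n b : ℕ) → List (Vec ℕ n)
allVecs zero    b = [ [] ]
allVecs (suc n) b = concatMap (λ x → map (x ∷_) (allVecs n b)) (upTo (suc b))

-- number of cylindric partitions of profile (c₁,c₂), each partition having
-- at most n parts, of size m.  (Every part is ≤ m, so entries in {0..m} suffice.)
cpCount : ℕ → ℕ → ℕ → ℕ → ℕ
cpCount c₁ c₂ n m =
  length (concatMap (λ l₁ →
    filter (λ l₂ → isCylindric c₁ c₂ l₁ l₂ ∧ (vsum l₁ + vsum l₂ ≡ᵇ m) Data.Bool.≟ true)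
           (allVecs n m))
    (allVecs n m))
  where import Data.Bool

CP : ℕ → ℕ → ℕ → FPS
CP c₁ c₂ n m = + (cpCount c₁ c₂ n m)

CP₄₀ : ℕ → FPS
CP₄₀ = CP 4 0

{-# OPTIONS --safe #-}
module Submission where

-- Let F(i,j) be the generating function of the cylindric partitions of profile
-- (4,0) in which λ¹ has at most i parts and λ² at most j parts, j ≤ i ≤ j + 4.
-- If the i + j allowed parts are all positive, one may be subtracted from each
-- of them; otherwise λ¹_i = 0 or λ²_j = 0.  Inclusion-exclusion gives
--   (1 - q^{i+j}) F(i,j) = F(i-1,j) + F(i,j-1) - F(i-1,j-1),
-- where on the two boundaries only one of the conditions matters:
-- (1 - q^{2n}) F(n,n) = F(n,n-1) and (1 - q^{2j+4}) F(j+4,j) = F(j+3,j).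
-- Eliminating the off-diagonal F(n,n-k), 1 ≤ k ≤ 4, from these relations leaves
-- a recurrence of order three for F(n,n) = CP(n).

open import Defs
open import Algebra.Bundles using (CommutativeRing)
open import Algebra.Solver.Ring.AlmostCommutativeRing using (fromCommutativeRing; _-Raw-AlmostCommutative⟶_)
open import Algebra.Structures using (IsCommutativeRing)
open import Data.Bool as Bool using (true; T; _∧_; if_then_else_)
open import Data.Bool.Properties using (T-∧; T-≡; T?)
open import Data.Integer as ℤ using (ℤ; +_)
import Data.Integer.Properties as ℤₚ
open import Data.Integer.Solver using (module +-*-Solver)
open import Data.List using (List; []; _∷_; map; upTo; filter; foldr; length; concatMap; cartesianProduct; cartesianProductWith; _++_)
open import Data.List.Membership.Propositional using (_∈_)
open import Data.List.Membership.Propositional.Properties using (∈-∃++; ∈-++⁻; ∈-++⁺ˡ; ∈-++⁺ʳ; ∈-filter⁺; ∈-filter⁻; ∈-upTo⁺; ∈-cartesianProductWith⁺; ∈-cartesianProduct⁺)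
open import Data.List.Properties using (filter-≐; filter-++; filter-none; length-++; map-upTo; map-applyUpTo)
import Data.List.Relation.Unary.All as All
open import Data.List.Relation.Unary.All using ([]; _∷_)
open import Data.List.Relation.Unary.AllPairs using ([]; _∷_)
open import Data.List.Relation.Unary.Any using (here; there)
open import Data.List.Relation.Unary.Unique.Propositional using (Unique)
import Data.List.Relation.Unary.Unique.Propositional.Properties as Unique
open import Data.Maybe using (Maybe; just; nothing)
open import Data.Nat using (ℕ; zero; suc; pred; _+_; _*_; _∸_; _≤_; _<_; _≤ᵇ_; _≡ᵇ_; _<?_; _≟_; z≤n; s≤s; NonZero)
open import Data.Nat.Divisibility using (_∣?_; ∣m∣n⇒∣m+n; ∣m+n∣m⇒∣n; ∣-refl; >⇒∤)
open import Data.Nat.Properties hiding (_≤?_; _<?_; _≟_)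
open import Data.Nat.Solver using () renaming (module +-*-Solver to ℕ-Solver)
open import Data.Product using (_×_; _,_; proj₁; proj₂)
open import Data.Sum using (inj₁; inj₂)
open import Data.Unit using (⊤; tt)
open import Data.Vec using (Vec; []; _∷_)
import Data.Vec.Properties as Vec
open import Algebra.Properties.CommutativeSemigroup +-commutativeSemigroup using (x∙yz≈y∙xz) renaming (interchange to +-interchange)
open import Function using (_∘_; Equivalence; mk⇔)
open import Level using (0ℓ)
open import Relation.Binary.PropositionalEquality using (_≡_; _≢_; refl; sym; trans; cong; cong₂; subst; subst₂; module ≡-Reasoning)
open import Relation.Nullary using (contradiction)
open import Relation.Nullary.Decidable using (yes; no; ¬?; _×-dec_; map′; does-⇔; dec-false)
open import Relation.Unary using (Decidable)

-- The ring of formal power series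

-- The bounds j ≤ i ≤ j + 4 make it possible to add 1 to all allowed parts without breaking the
-- interlacing: whenever the smaller entry of a compared pair is raised, so is the larger one. The
-- elimination closes because profile (4,0) cuts the row F(n,n-1), F(n,n-2), F(n,n-3), F(n,n-4) off
-- at difference 4, where the boundary relation leads back to F(n-1,n-4). The last three entries of
-- the row carry the factors 1 - q^{2n-2}, 1 - q^{2n-3}, 1 - q^{2n-4}. The computation multiplies by
-- these three instead of dividing, so it stays polynomial in the series, and inverses enter only at
-- the end. F(n-3,n-3) enters only through the relation that determines F(n-2,n-4). Since the
-- enumeration behind a coefficient changes with its index, counts over different lists are compared
-- through explicit bijections.

⊛-zero : ∀ f g → (f ⊛ g) 0 ≡ f 0 ℤ.* g 0
⊛-zero f g = ℤₚ.+-identityʳ _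

-- Splitting off the term `i = 0` leaves a convolution with a shifted left factor. The ring laws
-- then follow by induction on the index with `f` generalised, and no double sum has to be
-- reindexed.
⊛-suc : ∀ f g m → (f ⊛ g) (suc m) ≡ f 0 ℤ.* g (suc m) ℤ.+ ((f ∘ suc) ⊛ g) m
⊛-suc f g m = cong (λ xs → f 0 ℤ.* g (suc m) ℤ.+ foldr ℤ._+_ (+ 0) xs)
  (trans (map-applyUpTo suc (λ i → f i ℤ.* g (suc m ∸ i)) (suc m))
         (sym (map-upTo (λ i → f (suc i) ℤ.* g (m ∸ i)) (suc m))))

⊛-cong : ∀ {f f′ g g′} → f ≈ₛ f′ → g ≈ₛ g′ → f ⊛ g ≈ₛ f′ ⊛ g′
⊛-cong {f} {f′} {g} {g′} p r zero
  rewrite ⊛-zero f g | ⊛-zero f′ g′ = cong₂ ℤ._*_ (p 0) (r 0)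
⊛-cong {f} {f′} {g} {g′} p r (suc m)
  rewrite ⊛-suc f g m | ⊛-suc f′ g′ m =
  cong₂ ℤ._+_ (cong₂ ℤ._*_ (p 0) (r (suc m))) (⊛-cong (p ∘ suc) r m)

⊛-distribʳ : ∀ h f g → (f ⊕ g) ⊛ h ≈ₛ f ⊛ h ⊕ g ⊛ h
⊛-distribʳ h f g zero
  rewrite ⊛-zero (f ⊕ g) h | ⊛-zero f h | ⊛-zero g h = ℤₚ.*-distribʳ-+ (h 0) (f 0) (g 0)
⊛-distribʳ h f g (suc m)
  rewrite ⊛-suc (f ⊕ g) h m | ⊛-suc f h m | ⊛-suc g h m | ⊛-distribʳ h (f ∘ suc) (g ∘ suc) m =
  solve 5 (λ a b c x y → (a :+ b) :* c :+ (x :+ y) := a :* c :+ x :+ (b :* c :+ y)) refl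
    (f 0) (g 0) (h (suc m)) (((f ∘ suc) ⊛ h) m) (((g ∘ suc) ⊛ h) m)
  where open +-*-Solver

⊛-scaleˡ : ∀ c f g m → ((λ k → c ℤ.* f k) ⊛ g) m ≡ c ℤ.* (f ⊛ g) m
⊛-scaleˡ c f g zero
  rewrite ⊛-zero (λ k → c ℤ.* f k) g | ⊛-zero f g = ℤₚ.*-assoc c (f 0) (g 0)
⊛-scaleˡ c f g (suc m)
  rewrite ⊛-suc (λ k → c ℤ.* f k) g m | ⊛-suc f g m | ⊛-scaleˡ c (f ∘ suc) g m =
  solve 4 (λ c a b x → c :* a :* b :+ c :* x := c :* (a :* b :+ x)) refl
    c (f 0) (g (suc m)) (((f ∘ suc) ⊛ g) m)
  where open +-*-Solver

⊛-assoc : ∀ f g h → (f ⊛ g) ⊛ h ≈ₛ f ⊛ (g ⊛ h)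
⊛-assoc f g h zero
  rewrite ⊛-zero (f ⊛ g) h | ⊛-zero f g | ⊛-zero f (g ⊛ h) | ⊛-zero g h = ℤₚ.*-assoc (f 0) (g 0) (h 0)
⊛-assoc f g h (suc m) = begin
  ((f ⊛ g) ⊛ h) (suc m)
    ≡⟨ ⊛-suc (f ⊛ g) h m ⟩
  (f ⊛ g) 0 ℤ.* h (suc m) ℤ.+ (((f ⊛ g) ∘ suc) ⊛ h) m
    ≡⟨ cong₂ ℤ._+_ (cong (ℤ._* h (suc m)) (⊛-zero f g)) (⊛-cong {g = h} (⊛-suc f g) (λ _ → refl) m) ⟩
  f 0 ℤ.* g 0 ℤ.* h (suc m) ℤ.+ (((λ k → f 0 ℤ.* g (suc k)) ⊕ (f ∘ suc) ⊛ g) ⊛ h) m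
    ≡⟨ cong (λ x → f 0 ℤ.* g 0 ℤ.* h (suc m) ℤ.+ x) (trans
         (⊛-distribʳ h (λ k → f 0 ℤ.* g (suc k)) ((f ∘ suc) ⊛ g) m)
         (cong₂ ℤ._+_ (⊛-scaleˡ (f 0) (g ∘ suc) h m) (⊛-assoc (f ∘ suc) g h m))) ⟩
  f 0 ℤ.* g 0 ℤ.* h (suc m) ℤ.+ (f 0 ℤ.* ((g ∘ suc) ⊛ h) m ℤ.+ ((f ∘ suc) ⊛ (g ⊛ h)) m)
    ≡⟨ solve 5 (λ a b c x y → a :* b :* c :+ (a :* x :+ y) := a :* (b :* c :+ x) :+ y) refl
         (f 0) (g 0) (h (suc m)) (((g ∘ suc) ⊛ h) m) (((f ∘ suc) ⊛ (g ⊛ h)) m) ⟩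
  f 0 ℤ.* (g 0 ℤ.* h (suc m) ℤ.+ ((g ∘ suc) ⊛ h) m) ℤ.+ ((f ∘ suc) ⊛ (g ⊛ h)) m
    ≡⟨ cong (λ x → f 0 ℤ.* x ℤ.+ ((f ∘ suc) ⊛ (g ⊛ h)) m) (⊛-suc g h m) ⟨
  f 0 ℤ.* (g ⊛ h) (suc m) ℤ.+ ((f ∘ suc) ⊛ (g ⊛ h)) m
    ≡⟨ ⊛-suc f (g ⊛ h) m ⟨
  (f ⊛ (g ⊛ h)) (suc m) ∎
  where
    open ≡-Reasoning
    open +-*-Solver

-- `⊛-suc` peels only the left factor. Commuting at the smaller index `suc m` exposes the head of
-- the other factor, and commuting the remainder at `m` makes the expression symmetric. The double
-- peeling is why index 1 is a base case.
⊛-comm : ∀ f g → f ⊛ g ≈ₛ g ⊛ f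
⊛-comm f g zero rewrite ⊛-zero f g | ⊛-zero g f = ℤₚ.*-comm (f 0) (g 0)
⊛-comm f g (suc zero)
  rewrite ⊛-suc f g 0 | ⊛-suc g f 0 | ⊛-zero (f ∘ suc) g | ⊛-zero (g ∘ suc) f =
  solve 4 (λ a b c d → a :* b :+ c :* d := d :* c :+ b :* a) refl (f 0) (g 1) (f 1) (g 0)
  where open +-*-Solver
⊛-comm f g (suc (suc m)) = begin
  (f ⊛ g) (2 + m)
    ≡⟨ ⊛-suc f g (suc m) ⟩
  f 0 ℤ.* g (2 + m) ℤ.+ ((f ∘ suc) ⊛ g) (suc m)
    ≡⟨ cong (λ x → f 0 ℤ.* g (2 + m) ℤ.+ x)
         (trans (⊛-comm (f ∘ suc) g (suc m)) (⊛-suc g (f ∘ suc) m)) ⟩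
  f 0 ℤ.* g (2 + m) ℤ.+ (g 0 ℤ.* f (2 + m) ℤ.+ ((g ∘ suc) ⊛ (f ∘ suc)) m)
    ≡⟨ cong (λ x → f 0 ℤ.* g (2 + m) ℤ.+ (g 0 ℤ.* f (2 + m) ℤ.+ x)) (⊛-comm (g ∘ suc) (f ∘ suc) m) ⟩
  f 0 ℤ.* g (2 + m) ℤ.+ (g 0 ℤ.* f (2 + m) ℤ.+ ((f ∘ suc) ⊛ (g ∘ suc)) m)
    ≡⟨ solve 3 (λ a b x → a :+ (b :+ x) := b :+ (a :+ x)) refl
         (f 0 ℤ.* g (2 + m)) (g 0 ℤ.* f (2 + m)) (((f ∘ suc) ⊛ (g ∘ suc)) m) ⟩
  g 0 ℤ.* f (2 + m) ℤ.+ (f 0 ℤ.* g (2 + m) ℤ.+ ((f ∘ suc) ⊛ (g ∘ suc)) m)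
    ≡⟨ cong (λ x → g 0 ℤ.* f (2 + m) ℤ.+ x)
         (trans (⊛-comm (g ∘ suc) f (suc m)) (⊛-suc f (g ∘ suc) m)) ⟨
  g 0 ℤ.* f (2 + m) ℤ.+ ((g ∘ suc) ⊛ f) (suc m)
    ≡⟨ ⊛-suc g f (suc m) ⟨
  (g ⊛ f) (2 + m) ∎
  where
    open ≡-Reasoning
    open +-*-Solver

-- Uses the same test as `q^ 0`, so that `const (+ 1)` is `𝟙` by computation; `con (+ 1)` in the
-- solver calls depends on this.
const : ℤ → FPS
const c m = if 0 ≡ᵇ m then c else + 0

const-⊛ : ∀ c f m → (const c ⊛ f) m ≡ c ℤ.* f m
const-⊛ c f zero = ⊛-zero (const c) f
const-⊛ c f (suc m) = begin
  (const c ⊛ f) (suc m)                                ≡⟨ ⊛-suc (const c) f m ⟩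
  c ℤ.* f (suc m) ℤ.+ ((λ _ → + 0) ⊛ f) m              ≡⟨ cong (λ x → c ℤ.* f (suc m) ℤ.+ x) (zero-⊛ m) ⟩
  c ℤ.* f (suc m) ℤ.+ + 0                              ≡⟨ ℤₚ.+-identityʳ _ ⟩
  c ℤ.* f (suc m)                                      ∎
  where
    open ≡-Reasoning
    zero-⊛ : ∀ k → ((λ _ → + 0) ⊛ f) k ≡ + 0
    zero-⊛ zero    = ⊛-zero (λ _ → + 0) f
    zero-⊛ (suc k) = trans (⊛-suc (λ _ → + 0) f k) (trans (ℤₚ.+-identityˡ _) (zero-⊛ k))

⊛-identityˡ : ∀ f → 𝟙 ⊛ f ≈ₛ f
⊛-identityˡ f m = begin
  (𝟙 ⊛ f) m   ≡⟨ const-⊛ (+ 1) f m ⟩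
  + 1 ℤ.* f m ≡⟨ ℤₚ.*-identityˡ (f m) ⟩
  f m         ∎
  where open ≡-Reasoning

𝟘 : FPS
𝟘 _ = + 0

⊝_ : FPS → FPS
(⊝ f) m = ℤ.- f m

FPS-isCommutativeRing : IsCommutativeRing _≈ₛ_ _⊕_ _⊛_ ⊝_ 𝟘 𝟙
FPS-isCommutativeRing = record
  { isRing = record
    { +-isAbelianGroup = record
      { isGroup = record
        { isMonoid = record
          { isSemigroup = record
            { isMagma = record
              { isEquivalence = record
                { refl  = λ _ → refl
                ; sym   = λ p m → sym (p m)
                ; trans = λ p r m → trans (p m) (r m)
                }
              ; ∙-cong = λ p r m → cong₂ ℤ._+_ (p m) (r m)
              }
            ; assoc = λ f g h m → ℤₚ.+-assoc (f m) (g m) (h m)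
            }
          ; identity = (λ f m → ℤₚ.+-identityˡ (f m)) , (λ f m → ℤₚ.+-identityʳ (f m))
          }
        ; inverse = (λ f m → ℤₚ.+-inverseˡ (f m)) , (λ f m → ℤₚ.+-inverseʳ (f m))
        ; ⁻¹-cong = λ p m → cong ℤ.-_ (p m)
        }
      ; comm = λ f g m → ℤₚ.+-comm (f m) (g m)
      }
    ; *-cong = ⊛-cong
    ; *-assoc = ⊛-assoc
    ; *-identity = ⊛-identityˡ , (λ f m → trans (⊛-comm f 𝟙 m) (⊛-identityˡ f m))
    ; distrib = (λ f g h m → trans (⊛-comm f (g ⊕ h) m)
                  (trans (⊛-distribʳ f g h m) (cong₂ ℤ._+_ (⊛-comm g f m) (⊛-comm h f m))))
              , ⊛-distribʳ
    }
  ; *-comm = ⊛-comm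
  }

FPS-commutativeRing : CommutativeRing 0ℓ 0ℓ
FPS-commutativeRing = record { isCommutativeRing = FPS-isCommutativeRing }

open CommutativeRing FPS-commutativeRing using ()
  renaming (setoid to FPS-setoid; refl to ≈-refl; sym to ≈-sym; trans to ≈-trans)

⊕-cong : ∀ {f f′ g g′} → f ≈ₛ f′ → g ≈ₛ g′ → f ⊕ g ≈ₛ f′ ⊕ g′
⊕-cong p r m = cong₂ ℤ._+_ (p m) (r m)

⊖-cong : ∀ {f f′ g g′} → f ≈ₛ f′ → g ≈ₛ g′ → f ⊖ g ≈ₛ f′ ⊖ g′
⊖-cong p r m = cong₂ ℤ._-_ (p m) (r m)

⊛-congˡ : ∀ f {g g′} → g ≈ₛ g′ → f ⊛ g ≈ₛ f ⊛ g′
⊛-congˡ f r = ⊛-cong {f} (λ _ → refl) r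

-- Integer coefficients, embedded as constant series, give the ring solver a decidable equality to
-- normalise with.
const-morphism : CommutativeRing.rawRing ℤₚ.+-*-commutativeRing -Raw-AlmostCommutative⟶ fromCommutativeRing FPS-commutativeRing
const-morphism = record
  { ⟦_⟧    = const
  ; +-homo = λ { a b zero → refl ; a b (suc _) → refl }
  ; *-homo = λ { a b zero    → sym (const-⊛ a (const b) zero)
               ; a b (suc m) → sym (trans (const-⊛ a (const b) (suc m)) (ℤₚ.*-zeroʳ a)) }
  ; -‿homo = λ { a zero → refl ; a (suc _) → refl }
  ; 0-homo = λ { zero → refl ; (suc _) → refl }
  ; 1-homo = λ _ → refl
  }

const-≟ : ∀ a b → Maybe (const a ≈ₛ const b)
const-≟ a b with a ℤ.≟ b
... | yes a≡b = just (λ m → cong (λ c → const c m) a≡b)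
... | no  _   = nothing

module FPS-Solver where
  open import Algebra.Solver.Ring (CommutativeRing.rawRing ℤₚ.+-*-commutativeRing)
    (fromCommutativeRing FPS-commutativeRing) const-morphism const-≟ public

-- Powers of `q` as shifts, and the inverse of 1 - q^k

q^-⊛-< : ∀ s f {m} → m < s → (q^ s ⊛ f) m ≡ + 0
q^-⊛-< (suc s) f {zero}  _         = ⊛-zero (q^ (suc s)) f
q^-⊛-< (suc s) f {suc m} (s≤s m<s) =
  trans (⊛-suc (q^ (suc s)) f m) (trans (ℤₚ.+-identityˡ _) (q^-⊛-< s f m<s))

q^-⊛-+ : ∀ s f m → (q^ s ⊛ f) (s + m) ≡ f m
q^-⊛-+ zero    f m = ⊛-identityˡ f m
q^-⊛-+ (suc s) f m =
  trans (⊛-suc (q^ (suc s)) f (s + m)) (trans (ℤₚ.+-identityˡ _) (q^-⊛-+ s f m))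

data ShiftView (s : ℕ) : ℕ → Set where
  below : ∀ {m} → m < s → ShiftView s m
  above : ∀ m → ShiftView s (s + m)

shiftView : ∀ s m → ShiftView s m
shiftView zero    m       = above m
shiftView (suc s) zero    = below (s≤s z≤n)
shiftView (suc s) (suc m) with shiftView s m
... | below m<s = below (s≤s m<s)
... | above k   = above k

q^-+ : ∀ a b → q^ (a + b) ≈ₛ q^ a ⊛ q^ b
q^-+ zero    b m       = sym (⊛-identityˡ (q^ b) m)
q^-+ (suc a) b zero    = sym (⊛-zero (q^ (suc a)) (q^ b))
q^-+ (suc a) b (suc m) =
  trans (q^-+ a b m) (sym (trans (⊛-suc (q^ (suc a)) (q^ b) m) (ℤₚ.+-identityˡ _)))

1-q^ : ℕ → FPS
1-q^ k = 𝟙 ⊖ q^ k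

-- Coefficientwise: below `k` the only multiple of `k` is 0, and from `k` on, subtracting `k` from
-- the exponent does not affect divisibility by `k`.
inv1-q^-unfold : ∀ k → .{{NonZero k}} → inv1-q^ k ≈ₛ 𝟙 ⊕ q^ k ⊛ inv1-q^ k
inv1-q^-unfold k@(suc _) m with shiftView k m
... | below {zero}  0<k = refl
... | below {suc m} m<k rewrite q^-⊛-< k (inv1-q^ k) m<k =
  cong (λ b → if b then + 1 else + 0) (dec-false (k ∣? suc m) (>⇒∤ m<k))
... | above j
  rewrite q^-⊛-+ k (inv1-q^ k) j =
  trans (cong (λ b → if b then + 1 else + 0)
          (does-⇔ (mk⇔ (λ d → ∣m+n∣m⇒∣n d ∣-refl) (∣m∣n⇒∣m+n ∣-refl)) (k ∣? (k + j)) (k ∣? j)))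
        (sym (ℤₚ.+-identityˡ _))

inv1-q^-inverse : ∀ k → .{{NonZero k}} → inv1-q^ k ⊛ 1-q^ k ≈ₛ 𝟙
inv1-q^-inverse k = begin
  inv1-q^ k ⊛ (𝟙 ⊖ q^ k)
    ≈⟨ solve 2 (λ i x → i :* (con (+ 1) :- x) := i :- x :* i) (λ _ → refl) (inv1-q^ k) (q^ k) ⟩
  inv1-q^ k ⊖ q^ k ⊛ inv1-q^ k
    ≈⟨ (λ m → cong (ℤ._- (q^ k ⊛ inv1-q^ k) m) (inv1-q^-unfold k m)) ⟩
  𝟙 ⊕ q^ k ⊛ inv1-q^ k ⊖ q^ k ⊛ inv1-q^ k
    ≈⟨ solve 1 (λ y → con (+ 1) :+ y :- y := con (+ 1)) (λ _ → refl) (q^ k ⊛ inv1-q^ k) ⟩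
  𝟙 ∎
  where
    open FPS-Solver
    open import Relation.Binary.Reasoning.Setoid FPS-setoid

-- Counting in lists

private variable
  A B : Set

count : {P : A → Set} → Decidable P → List A → ℕ
count P? xs = length (filter P? xs)

count-⇔ : {P Q : A → Set} (P? : Decidable P) (Q? : Decidable Q) →
          (∀ {x} → P x → Q x) → (∀ {x} → Q x → P x) → ∀ xs → count P? xs ≡ count Q? xs
count-⇔ P? Q? P⇒Q Q⇒P xs = cong length (filter-≐ P? Q? (P⇒Q , Q⇒P) xs)

count-split : {P Q : A → Set} (P? : Decidable P) (Q? : Decidable Q) → ∀ xs →
              count P? xs ≡ count (λ x → P? x ×-dec Q? x) xs + count (λ x → P? x ×-dec ¬? (Q? x)) xs
count-split P? Q? [] = refl
count-split P? Q? (x ∷ xs) with P? x | Q? x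
... | no  _ | _     = count-split P? Q? xs
... | yes _ | yes _ = cong suc (count-split P? Q? xs)
... | yes _ | no  _ = trans (cong suc (count-split P? Q? xs)) (sym (+-suc _ _))

-- Pigeonhole by deletion: `f x` is cut out of `ys`, and the other elements of `xs` still land in
-- what remains, because `g` would otherwise identify one of them with `x`. The inverse law is
-- required only on `xs`, as suits maps that are inverse only on the objects counted.
length-≤-of-injection : {xs : List A} {ys : List B} (f : A → B) (g : B → A) → Unique xs →
                        (∀ {x} → x ∈ xs → f x ∈ ys) → (∀ {x} → x ∈ xs → g (f x) ≡ x) →
                        length xs ≤ length ys
length-≤-of-injection {xs = []} f g _ _ _ = z≤n
length-≤-of-injection {xs = x ∷ xs} f g (x∉xs ∷ uniq) f∈ gf
  with us , vs , refl ← ∈-∃++ (f∈ (here refl)) = begin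
    suc (length xs)                 ≤⟨ s≤s (length-≤-of-injection f g uniq f∈′ (gf ∘ there)) ⟩
    suc (length (us ++ vs))         ≡⟨ cong suc (length-++ us) ⟩
    suc (length us + length vs)     ≡⟨ +-suc _ _ ⟨
    length us + suc (length vs)     ≡⟨ length-++ us ⟨
    length (us ++ f x ∷ vs)         ∎
  where
    open ≤-Reasoning
    f∈′ : ∀ {y} → y ∈ xs → f y ∈ us ++ vs
    f∈′ {y} y∈xs with ∈-++⁻ us (f∈ (there y∈xs))
    ... | inj₁ ∈us         = ∈-++⁺ˡ ∈us
    ... | inj₂ (there ∈vs) = ∈-++⁺ʳ us ∈vs
    ... | inj₂ (here eq)   = contradiction
      (trans (sym (gf (here refl))) (trans (cong g (sym eq)) (gf (there y∈xs))))
      (All.lookup x∉xs y∈xs)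

-- The lists need only be repetition-free and contain every element with the property. Hence counts
-- over enumerations with different entry bounds or vector lengths can be compared.
count-bijection : {P : A → Set} {Q : B → Set} (P? : Decidable P) (Q? : Decidable Q)
                  {xs : List A} {ys : List B} → Unique xs → Unique ys →
                  (∀ {x} → P x → x ∈ xs) → (∀ {y} → Q y → y ∈ ys) →
                  (f : A → B) (g : B → A) →
                  (∀ {x} → P x → Q (f x)) → (∀ {y} → Q y → P (g y)) →
                  (∀ {x} → P x → g (f x) ≡ x) → (∀ {y} → Q y → f (g y) ≡ y) →
                  count P? xs ≡ count Q? ys
count-bijection P? Q? {xs} {ys} uxs uys P∈ Q∈ f g PQ QP gf fg = ≤-antisym
  (length-≤-of-injection f g (Unique.filter⁺ P? uxs)
    (λ x∈ → let px = proj₂ (∈-filter⁻ P? {xs = xs} x∈) in ∈-filter⁺ Q? (Q∈ (PQ px)) (PQ px))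
    (λ x∈ → gf (proj₂ (∈-filter⁻ P? {xs = xs} x∈))))
  (length-≤-of-injection g f (Unique.filter⁺ Q? uys)
    (λ y∈ → let qy = proj₂ (∈-filter⁻ Q? {xs = ys} y∈) in ∈-filter⁺ P? (P∈ (QP qy)) (QP qy))
    (λ y∈ → fg (proj₂ (∈-filter⁻ Q? {xs = ys} y∈))))

count-cartesianProduct : {P : A × B → Set} (P? : Decidable P) → ∀ xs ys →
  count P? (cartesianProduct xs ys) ≡ length (concatMap (λ x → filter (λ y → P? (x , y)) ys) xs)
count-cartesianProduct P? []       ys = refl
count-cartesianProduct {A = A} {B = B} P? (x ∷ xs) ys = begin
  length (filter P? (map (x ,_) ys ++ cartesianProduct xs ys))
    ≡⟨ cong length (filter-++ P? (map (x ,_) ys) _) ⟩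
  length (filter P? (map (x ,_) ys) ++ filter P? (cartesianProduct xs ys))
    ≡⟨ length-++ (filter P? (map (x ,_) ys)) ⟩
  count P? (map (x ,_) ys) + count P? (cartesianProduct xs ys)
    ≡⟨ cong₂ _+_ (count-map ys) (count-cartesianProduct P? xs ys) ⟩
  count (λ y → P? (x , y)) ys + length (concatMap (λ x → filter (λ y → P? (x , y)) ys) xs)
    ≡⟨ length-++ (filter (λ y → P? (x , y)) ys) ⟨
  length (concatMap (λ x → filter (λ y → P? (x , y)) ys) (x ∷ xs)) ∎
  where
    open ≡-Reasoning
    count-map : ∀ ys → count P? (map (x ,_) ys) ≡ count (λ y → P? (x , y)) ys
    count-map [] = refl
    count-map (y ∷ ys) with P? (x , y)
    ... | yes _ = cong suc (count-map ys)
    ... | no  _ = count-map ys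

concatMap-map : ∀ {C : Set} (f : A → B → C) xs ys →
                concatMap (λ x → map (f x) ys) xs ≡ cartesianProductWith f xs ys
concatMap-map f []       ys = refl
concatMap-map f (x ∷ xs) ys = cong (map (f x) ys ++_) (concatMap-map f xs ys)

-- Enumerations of vectors and pairs

allVecs-unique : ∀ n b → Unique (allVecs n b)
allVecs-unique zero    b = [] ∷ []
allVecs-unique (suc n) b
  rewrite concatMap-map (λ x (v : Vec ℕ n) → x ∷ v) (upTo (suc b)) (allVecs n b) =
  Unique.cartesianProductWith⁺ _∷_ Vec.∷-injective (Unique.upTo⁺ (suc b)) (allVecs-unique n b)

∈-allVecs : ∀ {n b} (v : Vec ℕ n) → vsum v ≤ b → v ∈ allVecs n b
∈-allVecs []      _  = here refl
∈-allVecs {suc n} {b} (x ∷ v) ≤b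
  rewrite concatMap-map (λ x (v : Vec ℕ n) → x ∷ v) (upTo (suc b)) (allVecs n b) =
  ∈-cartesianProductWith⁺ _∷_ (∈-upTo⁺ (s≤s (m+n≤o⇒m≤o x ≤b))) (∈-allVecs v (m+n≤o⇒n≤o x ≤b))

allPairs : ∀ n b → List (Vec ℕ n × Vec ℕ n)
allPairs n b = cartesianProduct (allVecs n b) (allVecs n b)

allPairs-unique : ∀ n b → Unique (allPairs n b)
allPairs-unique n b = Unique.cartesianProduct⁺ (allVecs-unique n b) (allVecs-unique n b)

∈-allPairs : ∀ {n b} (v w : Vec ℕ n) → vsum v + vsum w ≡ b → (v , w) ∈ allPairs n b
∈-allPairs v w refl = ∈-cartesianProduct⁺ (∈-allVecs v (m≤m+n _ _)) (∈-allVecs w (m≤n+m _ _))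

-- Vectors as finitely supported sequences

at-≥ : ∀ {n} (v : Vec ℕ n) {k} → n ≤ k → at v k ≡ 0
at-≥ []      _          = refl
at-≥ (x ∷ v) (s≤s n≤k) = at-≥ v n≤k

at-injective : ∀ {n} {v w : Vec ℕ n} → (∀ k → at v k ≡ at w k) → v ≡ w
at-injective {v = []}    {[]}    eq = refl
at-injective {v = x ∷ v} {y ∷ w} eq = cong₂ _∷_ (eq 0) (at-injective (eq ∘ suc))

vsum-cong : ∀ {m n} (v : Vec ℕ m) (w : Vec ℕ n) → (∀ k → at v k ≡ at w k) → vsum v ≡ vsum w
vsum-cong []      []      eq = refl
vsum-cong []      (y ∷ w) eq = cong₂ _+_ (eq 0) (vsum-cong [] w (eq ∘ suc))
vsum-cong (x ∷ v) []      eq = cong₂ _+_ (eq 0) (vsum-cong v [] (eq ∘ suc))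
vsum-cong (x ∷ v) (y ∷ w) eq = cong₂ _+_ (eq 0) (vsum-cong v w (eq ∘ suc))

resize : ∀ {m} n → Vec ℕ m → Vec ℕ n
resize zero    v       = []
resize (suc n) []      = 0 ∷ resize n []
resize (suc n) (x ∷ v) = x ∷ resize n v

at-resize : ∀ {m} n (v : Vec ℕ m) → (∀ {k} → n ≤ k → at v k ≡ 0) → ∀ k → at (resize n v) k ≡ at v k
at-resize zero    v       v≡0 k       = sym (v≡0 z≤n)
at-resize (suc n) []      v≡0 zero    = refl
at-resize (suc n) []      v≡0 (suc k) = at-resize n [] (λ _ → refl) k
at-resize (suc n) (x ∷ v) v≡0 zero    = refl
at-resize (suc n) (x ∷ v) v≡0 (suc k) = at-resize n v (v≡0 ∘ s≤s) k

-- From Boolean checks to quantified inequalities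

allBelow-suc : ∀ n p → allBelow (suc n) p ≡ p 0 ∧ allBelow n (p ∘ suc)
allBelow-suc n p = cong (λ bs → p 0 ∧ foldr _∧_ true bs)
  (trans (map-applyUpTo suc p n) (sym (map-upTo (p ∘ suc) n)))

T-allBelow⁻ : ∀ n p → T (allBelow n p) → ∀ {k} → k < n → T (p k)
T-allBelow⁻ (suc n) p t {zero}  _         = proj₁ (Equivalence.to T-∧ (subst T (allBelow-suc n p) t))
T-allBelow⁻ (suc n) p t {suc k} (s≤s k<n) =
  T-allBelow⁻ n (p ∘ suc) (proj₂ (Equivalence.to (T-∧ {p 0}) (subst T (allBelow-suc n p) t))) k<n

T-allBelow⁺ : ∀ n p → (∀ {k} → k < n → T (p k)) → T (allBelow n p)
T-allBelow⁺ zero    p h = tt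
T-allBelow⁺ (suc n) p h = subst T (sym (allBelow-suc n p))
  (Equivalence.from T-∧ (h (s≤s z≤n) , T-allBelow⁺ n (p ∘ suc) (h ∘ s≤s)))

-- Covers all four cylindric conditions: being a partition is `Dominates 1 v v`. One lemma about
-- `inc` and one about `dec` therefore handle them all.
record Dominates {m n} (c : ℕ) (v : Vec ℕ m) (w : Vec ℕ n) : Set where
  constructor dominates
  field at-≤ : ∀ k → at w (k + c) ≤ at v k

open Dominates

record Cylindric (c₁ c₂ : ℕ) {n} (p : Vec ℕ n × Vec ℕ n) : Set where
  constructor cylindric
  field
    partition₁ : Dominates 1 (proj₁ p) (proj₁ p)
    partition₂ : Dominates 1 (proj₂ p) (proj₂ p)
    dominates₁ : Dominates c₂ (proj₁ p) (proj₂ p)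
    dominates₂ : Dominates c₁ (proj₂ p) (proj₁ p)

Dominates-below : ∀ {m n} c (v : Vec ℕ m) (w : Vec ℕ n) → n ≤ m →
                  (∀ {k} → k < m → at w (k + c) ≤ at v k) → Dominates c v w
at-≤ (Dominates-below {m} c v w n≤m h) k with k <? m
... | yes k<m = h k<m
... | no  k≮m = ≤-trans (≤-reflexive (at-≥ w (≤-trans n≤m (≤-trans (≮⇒≥ k≮m) (m≤m+n k c))))) z≤n

isPartition⁻ : ∀ {n} (v : Vec ℕ n) → T (isPartition v) → Dominates 1 v v
isPartition⁻ {n} v t = Dominates-below 1 v v ≤-refl λ {k} k<n →
  subst (λ j → at v j ≤ at v k) (+-comm 1 k) (≤ᵇ⇒≤ _ _ (T-allBelow⁻ n _ t k<n))

isPartition⁺ : ∀ {n} (v : Vec ℕ n) → Dominates 1 v v → T (isPartition v)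
isPartition⁺ {n} v d = T-allBelow⁺ n _ λ {k} _ →
  ≤⇒≤ᵇ (subst (λ j → at v j ≤ at v k) (+-comm k 1) (at-≤ d k))

isCylindric⁻ : ∀ {c₁ c₂ n} (v w : Vec ℕ n) → T (isCylindric c₁ c₂ v w) → Cylindric c₁ c₂ (v , w)
isCylindric⁻ {c₁} {c₂} {n} v w t
  with tv , t′ ← Equivalence.to (T-∧ {isPartition v}) t
  with tw , td ← Equivalence.to (T-∧ {isPartition w}) t′ =
  cylindric (isPartition⁻ v tv) (isPartition⁻ w tw)
    (Dominates-below c₂ v w ≤-refl λ {k} k<n → ≤ᵇ⇒≤ _ _ (proj₁ (both k<n)))
    (Dominates-below c₁ w v ≤-refl λ {k} k<n → ≤ᵇ⇒≤ _ _ (proj₂ (both k<n)))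
  where
    both : ∀ {k} → k < n → T (at w (k + c₂) ≤ᵇ at v k) × T (at v (k + c₁) ≤ᵇ at w k)
    both {k} k<n = Equivalence.to (T-∧ {at w (k + c₂) ≤ᵇ at v k}) (T-allBelow⁻ n _ td k<n)

isCylindric⁺ : ∀ {c₁ c₂ n} (v w : Vec ℕ n) → Cylindric c₁ c₂ (v , w) → T (isCylindric c₁ c₂ v w)
isCylindric⁺ {n = n} v w (cylindric pv pw d₁ d₂) =
  Equivalence.from T-∧ (isPartition⁺ v pv , Equivalence.from T-∧ (isPartition⁺ w pw ,
    T-allBelow⁺ n _ λ {k} _ → Equivalence.from T-∧ (≤⇒≤ᵇ (at-≤ d₁ k) , ≤⇒≤ᵇ (at-≤ d₂ k))))

Cylindric? : ∀ c₁ c₂ {n} → Decidable (Cylindric c₁ c₂ {n})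
Cylindric? c₁ c₂ (v , w) = map′ (isCylindric⁻ v w) (isCylindric⁺ v w) (T? _)

-- Cylindric partitions with bounded numbers of parts

inc : ∀ {n} → ℕ → Vec ℕ n → Vec ℕ n
inc zero    v       = v
inc (suc i) []      = []
inc (suc i) (x ∷ v) = suc x ∷ inc i v

dec : ∀ {n} → ℕ → Vec ℕ n → Vec ℕ n
dec zero    v       = v
dec (suc i) []      = []
dec (suc i) (x ∷ v) = pred x ∷ dec i v

at-inc-< : ∀ {n i k} (v : Vec ℕ n) → i ≤ n → k < i → at (inc i v) k ≡ suc (at v k)
at-inc-< {i = suc i} {zero}  (x ∷ v) _         _         = refl
at-inc-< {i = suc i} {suc k} (x ∷ v) (s≤s i≤n) (s≤s k<i) = at-inc-< v i≤n k<i

at-inc-≥ : ∀ {n i k} (v : Vec ℕ n) → i ≤ k → at (inc i v) k ≡ at v k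
at-inc-≥ {i = zero}  v       _         = refl
at-inc-≥ {i = suc i} []      _         = refl
at-inc-≥ {i = suc i} (x ∷ v) (s≤s i≤k) = at-inc-≥ v i≤k

at-≤-inc : ∀ {n} i (v : Vec ℕ n) k → at v k ≤ at (inc i v) k
at-≤-inc zero    v       k       = ≤-refl
at-≤-inc (suc i) []      k       = ≤-refl
at-≤-inc (suc i) (x ∷ v) zero    = n≤1+n x
at-≤-inc (suc i) (x ∷ v) (suc k) = at-≤-inc i v k

at-dec-< : ∀ {n i k} (v : Vec ℕ n) → k < i → at (dec i v) k ≡ pred (at v k)
at-dec-< {i = suc i}         []      _         = refl
at-dec-< {i = suc i} {zero}  (x ∷ v) _         = refl
at-dec-< {i = suc i} {suc k} (x ∷ v) (s≤s k<i) = at-dec-< v k<i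

at-dec-≥ : ∀ {n i k} (v : Vec ℕ n) → i ≤ k → at (dec i v) k ≡ at v k
at-dec-≥ {i = zero}  v       _         = refl
at-dec-≥ {i = suc i} []      _         = refl
at-dec-≥ {i = suc i} (x ∷ v) (s≤s i≤k) = at-dec-≥ v i≤k

vsum-inc : ∀ {n i} (v : Vec ℕ n) → i ≤ n → vsum (inc i v) ≡ i + vsum v
vsum-inc {i = zero}  v       _         = refl
vsum-inc {i = suc i} (x ∷ v) (s≤s i≤n) =
  cong suc (trans (cong (λ y → x + y) (vsum-inc v i≤n)) (x∙yz≈y∙xz x i (vsum v)))

dec-inc : ∀ {n} i (v : Vec ℕ n) → dec i (inc i v) ≡ v
dec-inc zero    v       = refl
dec-inc (suc i) []      = refl
dec-inc (suc i) (x ∷ v) = cong (x ∷_) (dec-inc i v)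

inc-dec : ∀ {n} i (v : Vec ℕ n) → (∀ {k} → k < i → at v k ≢ 0) → inc i (dec i v) ≡ v
inc-dec zero    v           _   = refl
inc-dec (suc i) []          _   = refl
inc-dec (suc i) (zero ∷ v)  v≢0 = contradiction refl (v≢0 (s≤s z≤n))
inc-dec (suc i) (suc x ∷ v) v≢0 = cong (suc x ∷_) (inc-dec i v (v≢0 ∘ s≤s))

-- If the entry of `w` is raised, the implication says that its partner in `v` is raised as well;
-- otherwise only the larger side can grow.
Dominates-inc : ∀ {n c} i j (v w : Vec ℕ n) → i ≤ n → j ≤ n → (∀ {k} → k + c < j → k < i) →
                Dominates c v w → Dominates c (inc i v) (inc j w)
at-≤ (Dominates-inc {c = c} i j v w i≤n j≤n imp d) k with k + c <? j
... | yes k+c<j rewrite at-inc-< w j≤n k+c<j | at-inc-< v i≤n (imp k+c<j) = s≤s (at-≤ d k)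
... | no  k+c≮j rewrite at-inc-≥ w (≮⇒≥ k+c≮j) = ≤-trans (at-≤ d k) (at-≤-inc i v k)

-- Within the first `j` positions both entries drop and `pred` is monotone; from position `j` on the
-- smaller side is zero.
Dominates-dec : ∀ {n c} i j (v w : Vec ℕ n) → (∀ {k} → j ≤ k → at w k ≡ 0) → (∀ {k} → k + c < j → k < i) →
                Dominates c v w → Dominates c (dec i v) (dec j w)
at-≤ (Dominates-dec {c = c} i j v w w≡0 imp d) k with k + c <? j
... | yes k+c<j rewrite at-dec-< w k+c<j | at-dec-< v (imp k+c<j) = pred-mono-≤ (at-≤ d k)
... | no  k+c≮j rewrite at-dec-≥ w (≮⇒≥ k+c≮j) | w≡0 (≮⇒≥ k+c≮j) = z≤n

partition-antitone : ∀ {n} {v : Vec ℕ n} → Dominates 1 v v → ∀ {i k} → i ≤ k → at v k ≤ at v i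
partition-antitone {v = v} d {i} {k} i≤k with m≤n⇒m<n∨m≡n i≤k
... | inj₂ refl = ≤-refl
partition-antitone {v = v} d {i} {suc k} _ | inj₁ (s≤s i≤k) =
  ≤-trans (subst (λ j → at v j ≤ at v k) (+-comm k 1) (at-≤ d k)) (partition-antitone d i≤k)

partition-zero : ∀ {n} {v : Vec ℕ n} → Dominates 1 v v → ∀ i {k} → at v i ≡ 0 → i ≤ k → at v k ≡ 0
partition-zero d i v≡0 i≤k = n≤0⇒n≡0 (≤-trans (partition-antitone d i≤k) (≤-reflexive v≡0))

-- For a partition v this says that all of the first i parts are positive.
Positive : ∀ {n} → ℕ → Vec ℕ n → Set
Positive zero    v = ⊤
Positive (suc i) v = at v i ≢ 0

Positive? : ∀ {n} i → Decidable (Positive {n} i)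
Positive? zero    v = yes tt
Positive? (suc i) v = ¬? (at v i ≟ 0)

partition-positive : ∀ {n} {v : Vec ℕ n} i → Dominates 1 v v → Positive i v → ∀ {k} → k < i → at v k ≢ 0
partition-positive (suc i) d v≢0 {k} (s≤s k≤i) v≡0 = v≢0 (partition-zero d k v≡0 k≤i)

-- Recurrences for a general profile `(c₁, c₂)`

module Shapes (c₁ c₂ N : ℕ) where

  -- At most i and at most j parts; all shapes share the ambient length N, so that they are literally nested.
  record Shape (i j m : ℕ) (p : Vec ℕ N × Vec ℕ N) : Set where
    constructor shape
    field
      cyl    : Cylindric c₁ c₂ p
      parts₁ : at (proj₁ p) i ≡ 0
      parts₂ : at (proj₂ p) j ≡ 0
      size   : vsum (proj₁ p) + vsum (proj₂ p) ≡ m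
    open Cylindric cyl public

  Shape? : ∀ i j m → Decidable (Shape i j m)
  Shape? i j m p = map′ (λ (c , x , y , s) → shape c x y s) (λ (shape c x y s) → c , x , y , s)
    (Cylindric? c₁ c₂ p ×-dec at (proj₁ p) i ≟ 0 ×-dec at (proj₂ p) j ≟ 0
      ×-dec vsum (proj₁ p) + vsum (proj₂ p) ≟ m)

  F : ℕ → ℕ → FPS
  F i j m = + count (Shape? i j m) (allPairs N m)

  Full : (i j m : ℕ) (p : Vec ℕ N × Vec ℕ N) → Set
  Full i j m p = Shape i j m p × Positive i (proj₁ p) × Positive j (proj₂ p)

  Full? : ∀ i j m → Decidable (Full i j m)
  Full? i j m p = Shape? i j m p ×-dec Positive? i (proj₁ p) ×-dec Positive? j (proj₂ p)

  ∈-allPairs-Shape : ∀ {i j m p} → Shape i j m p → p ∈ allPairs N m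
  ∈-allPairs-Shape s = ∈-allPairs _ _ (Shape.size s)

  module _ {i j : ℕ} (i≤N : i ≤ N) (j≤N : j ≤ N) (i≤ : i ≤ j + c₁) (j≤ : j ≤ i + c₂) where

    inc-pair dec-pair : Vec ℕ N × Vec ℕ N → Vec ℕ N × Vec ℕ N
    inc-pair (v , w) = inc i v , inc j w
    dec-pair (v , w) = dec i v , dec j w

    imp₁ : ∀ {k} → k + c₂ < j → k < i
    imp₁ k< = +-cancelʳ-< c₂ _ _ (<-≤-trans k< j≤)

    imp₂ : ∀ {k} → k + c₁ < i → k < j
    imp₂ k< = +-cancelʳ-< c₁ _ _ (<-≤-trans k< i≤)

    imp : ∀ {k l} → k + 1 < l → k < l
    imp = ≤-<-trans (m≤m+n _ 1)

    inc-Full : ∀ {m p} → Shape i j m p → Full i j (i + j + m) (inc-pair p)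
    inc-Full {m} {v , w} (shape (cylindric dv dw d₁ d₂) v≡0 w≡0 refl) =
      shape (cylindric (Dominates-inc i i v v i≤N i≤N imp dv) (Dominates-inc j j w w j≤N j≤N imp dw)
                       (Dominates-inc i j v w i≤N j≤N imp₁ d₁) (Dominates-inc j i w v j≤N i≤N imp₂ d₂))
            (trans (at-inc-≥ v ≤-refl) v≡0) (trans (at-inc-≥ w ≤-refl) w≡0)
            (trans (cong₂ _+_ (vsum-inc v i≤N) (vsum-inc w j≤N)) (+-interchange i (vsum v) j (vsum w)))
      , inc-Positive i≤N v , inc-Positive j≤N w
      where
        inc-Positive : ∀ {i} → i ≤ N → (v : Vec ℕ N) → Positive i (inc i v)
        inc-Positive {zero}  _   v = tt
        inc-Positive {suc i} i<N v eq with () ← trans (sym eq) (at-inc-< v i<N ≤-refl)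

    inc-dec-pair : ∀ {m p} → Full i j m p → inc-pair (dec-pair p) ≡ p
    inc-dec-pair {p = v , w} (s , pv , pw) = cong₂ _,_
      (inc-dec i v (partition-positive i (Shape.partition₁ s) pv))
      (inc-dec j w (partition-positive j (Shape.partition₂ s) pw))

    -- Written additively to avoid truncated subtraction. It serves twice: it shows that no full
    -- pair has size below `i + j`, and by cancellation it gives the size after `dec-pair`.
    Full-size : ∀ {m p} → Full i j m p → m ≡ i + j + (vsum (proj₁ (dec-pair p)) + vsum (proj₂ (dec-pair p)))
    Full-size {m} {p@(v , w)} full@(s , _) = begin
      m                                                  ≡⟨ Shape.size s ⟨
      vsum v + vsum w                                    ≡⟨ cong (λ (v , w) → vsum v + vsum w) (inc-dec-pair full) ⟨
      vsum (inc i (dec i v)) + vsum (inc j (dec j w))    ≡⟨ cong₂ _+_ (vsum-inc (dec i v) i≤N) (vsum-inc (dec j w) j≤N) ⟩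
      i + vsum (dec i v) + (j + vsum (dec j w))          ≡⟨ +-interchange i _ j _ ⟩
      i + j + (vsum (dec i v) + vsum (dec j w))          ∎
      where open ≡-Reasoning

    dec-Shape : ∀ {m p} → Full i j (i + j + m) p → Shape i j m (dec-pair p)
    dec-Shape {m} {v , w} full@(shape (cylindric dv dw d₁ d₂) v≡0 w≡0 _ , _) =
      shape (cylindric (Dominates-dec i i v v (partition-zero dv i v≡0) imp dv)
                       (Dominates-dec j j w w (partition-zero dw j w≡0) imp dw)
                       (Dominates-dec i j v w (partition-zero dw j w≡0) imp₁ d₁)
                       (Dominates-dec j i w v (partition-zero dv i v≡0) imp₂ d₂))
            (trans (at-dec-≥ v ≤-refl) v≡0) (trans (at-dec-≥ w ≤-refl) w≡0)
            (+-cancelˡ-≡ (i + j) _ _ (sym (Full-size full)))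

    -- `dec-pair` and `inc-pair` are inverse bijections between full pairs of size `i + j + k` and
    -- shapes of size `k`, which is the shift by `q^ (i + j)`.
    count-Full : ∀ m → + count (Full? i j m) (allPairs N m) ≡ (q^ (i + j) ⊛ F i j) m
    count-Full m with shiftView (i + j) m
    ... | below m< rewrite q^-⊛-< (i + j) (F i j) m< =
      cong (λ xs → + length xs) (filter-none (Full? i j m) {xs = allPairs N m} (All.tabulate λ _ full →
        <⇒≱ m< (≤-trans (m≤m+n (i + j) _) (≤-reflexive (sym (Full-size full))))))
    ... | above k rewrite q^-⊛-+ (i + j) (F i j) k =
      cong +_ (count-bijection (Full? i j (i + j + k)) (Shape? i j k)
        (allPairs-unique N (i + j + k)) (allPairs-unique N k)
        (∈-allPairs-Shape ∘ proj₁) ∈-allPairs-Shape dec-pair inc-pair dec-Shape inc-Full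
        inc-dec-pair (λ {(v , w)} _ → cong₂ _,_ (dec-inc i v) (dec-inc j w)))

  Shape-reindex : ∀ {i j i′ j′ m p} → Shape i j m p →
    at (proj₁ p) i′ ≡ 0 → at (proj₂ p) j′ ≡ 0 → Shape i′ j′ m p
  Shape-reindex s x y = shape (Shape.cyl s) x y (Shape.size s)

  Shape-weaken₁ : ∀ {i j m p} → Shape i j m p → Shape (suc i) j m p
  Shape-weaken₁ {i} s = Shape-reindex s (partition-zero (Shape.partition₁ s) i (Shape.parts₁ s) (n≤1+n i)) (Shape.parts₂ s)

  Shape-weaken₂ : ∀ {i j m p} → Shape i j m p → Shape i (suc j) m p
  Shape-weaken₂ {j = j} s = Shape-reindex s (Shape.parts₁ s) (partition-zero (Shape.partition₂ s) j (Shape.parts₂ s) (n≤1+n j))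

  count-split₁ : ∀ i j m → count (Shape? (suc i) j m) (allPairs N m) ≡
    count (Shape? i j m) (allPairs N m)
    + count (λ p → Shape? (suc i) j m p ×-dec ¬? (at (proj₁ p) i ≟ 0)) (allPairs N m)
  count-split₁ i j m = trans (count-split (Shape? (suc i) j m) (λ p → at (proj₁ p) i ≟ 0) (allPairs N m))
    (cong₂ _+_ (count-⇔ _ (Shape? i j m)
      (λ (s , z) → Shape-reindex s z (Shape.parts₂ s)) (λ s → Shape-weaken₁ s , Shape.parts₁ s) (allPairs N m)) refl)

  count-split₂ : ∀ i j m → count (Shape? i (suc j) m) (allPairs N m) ≡
    count (Shape? i j m) (allPairs N m)
    + count (λ p → Shape? i (suc j) m p ×-dec ¬? (at (proj₂ p) j ≟ 0)) (allPairs N m)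
  count-split₂ i j m = trans (count-split (Shape? i (suc j) m) (λ p → at (proj₂ p) j ≟ 0) (allPairs N m))
    (cong₂ _+_ (count-⇔ _ (Shape? i j m)
      (λ (s , z) → Shape-reindex s (Shape.parts₁ s) z) (λ s → Shape-weaken₂ s , Shape.parts₂ s) (allPairs N m)) refl)

  F-remainder : ∀ {i j} → i ≤ N → j ≤ N → i ≤ j + c₁ → j ≤ i + c₂ → ∀ m →
    (1-q^ (i + j) ⊛ F i j) m ≡ F i j m ℤ.- + count (Full? i j m) (allPairs N m)
  F-remainder {i} {j} i≤N j≤N i≤ j≤ m = trans
    (solve 2 (λ x f → (con (+ 1) :- x) :* f := f :- x :* f) (λ _ → refl) (q^ (i + j)) (F i j) m)
    (cong (λ x → F i j m ℤ.- x) (sym (count-Full i≤N j≤N i≤ j≤ m)))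
    where open FPS-Solver

  -- By `pos`, a positive last allowed part of λ¹ already makes the pair full, so the pairs that are
  -- not full are those with one part fewer in λ¹.
  F-corner₁ : ∀ {i j} → suc i ≤ N → j ≤ N → suc i ≤ j + c₁ → j ≤ suc i + c₂ →
    (∀ {p} → Cylindric c₁ c₂ p → at (proj₁ p) i ≢ 0 → Positive j (proj₂ p)) →
    1-q^ (suc i + j) ⊛ F (suc i) j ≈ₛ F i j
  F-corner₁ {i} {j} i<N j≤N i< j≤ pos m = begin
    (1-q^ (suc i + j) ⊛ F (suc i) j) m  ≡⟨ F-remainder i<N j≤N i< j≤ m ⟩
    F (suc i) j m ℤ.- full              ≡⟨ cong (ℤ._- full) (cong +_ split) ⟩
    F i j m ℤ.+ full ℤ.- full           ≡⟨ solve 2 (λ x y → x :+ y :- y := x) refl (F i j m) full ⟩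
    F i j m                             ∎
    where
      open ≡-Reasoning
      open +-*-Solver
      full = + count (Full? (suc i) j m) (allPairs N m)
      split = trans (count-split₁ i j m) (cong (λ x → count (Shape? i j m) (allPairs N m) + x)
        (count-⇔ _ (Full? (suc i) j m)
          (λ (s , z) → s , z , pos (Shape.cyl s) z) (λ (s , z , _) → s , z) (allPairs N m)))

  F-corner₂ : ∀ {i j} → i ≤ N → suc j ≤ N → i ≤ suc j + c₁ → suc j ≤ i + c₂ →
    (∀ {p} → Cylindric c₁ c₂ p → at (proj₂ p) j ≢ 0 → Positive i (proj₁ p)) →
    1-q^ (i + suc j) ⊛ F i (suc j) ≈ₛ F i j
  F-corner₂ {i} {j} i≤N j<N i≤ j< pos m = begin
    (1-q^ (i + suc j) ⊛ F i (suc j)) m  ≡⟨ F-remainder i≤N j<N i≤ j< m ⟩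
    F i (suc j) m ℤ.- full              ≡⟨ cong (ℤ._- full) (cong +_ split) ⟩
    F i j m ℤ.+ full ℤ.- full           ≡⟨ solve 2 (λ x y → x :+ y :- y := x) refl (F i j m) full ⟩
    F i j m                             ∎
    where
      open ≡-Reasoning
      open +-*-Solver
      full = + count (Full? i (suc j) m) (allPairs N m)
      split = trans (count-split₂ i j m) (cong (λ x → count (Shape? i j m) (allPairs N m) + x)
        (count-⇔ _ (Full? i (suc j) m)
          (λ (s , z) → s , pos (Shape.cyl s) z , z) (λ (s , _ , z) → s , z) (allPairs N m)))

  -- The inclusion-exclusion is done by disjoint splitting: first by whether the last allowed part
  -- of λ¹ vanishes, then, among the pairs where it does not, by the last allowed part of λ².
  F-interior : ∀ {i j} → suc i ≤ N → suc j ≤ N → suc i ≤ suc j + c₁ → suc j ≤ suc i + c₂ →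
    1-q^ (suc i + suc j) ⊛ F (suc i) (suc j) ≈ₛ F i (suc j) ⊕ F (suc i) j ⊖ F i j
  F-interior {i} {j} i<N j<N i< j< m = begin
    (1-q^ (suc i + suc j) ⊛ F (suc i) (suc j)) m
      ≡⟨ F-remainder i<N j<N i< j< m ⟩
    F (suc i) (suc j) m ℤ.- + full
      ≡⟨ cong (ℤ._- + full) (cong +_ (trans (count-split₁ i (suc j) m) (cong (λ x → n₀₁ + x) split))) ⟩
    F i (suc j) m ℤ.+ (+ b≡0 ℤ.+ + full) ℤ.- + full
      ≡⟨ solve 4 (λ x y z w → x :+ (y :+ z) :- z := x :+ (w :+ y) :- w) refl (F i (suc j) m) (+ b≡0) (+ full) (F i j m) ⟩
    F i (suc j) m ℤ.+ (F i j m ℤ.+ + b≡0) ℤ.- F i j m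
      -- `b≡0` is also the second class when `F (suc i) j` is split by λ¹, so it equals the
      -- difference of `F (suc i) j` and `F i j`.
      ≡⟨ cong (λ x → F i (suc j) m ℤ.+ + x ℤ.- F i j m) (count-split₁ i j m) ⟨
    F i (suc j) m ℤ.+ F (suc i) j m ℤ.- F i j m ∎
    where
      open ≡-Reasoning
      open +-*-Solver
      n₀₁  = count (Shape? i (suc j) m) (allPairs N m)
      full = count (Full? (suc i) (suc j) m) (allPairs N m)
      b≡0  = count (λ p → Shape? (suc i) j m p ×-dec ¬? (at (proj₁ p) i ≟ 0)) (allPairs N m)
      split : count (λ p → Shape? (suc i) (suc j) m p ×-dec ¬? (at (proj₁ p) i ≟ 0)) (allPairs N m) ≡ b≡0 + full
      split = trans
        (count-split (λ p → Shape? (suc i) (suc j) m p ×-dec ¬? (at (proj₁ p) i ≟ 0))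
          (λ p → at (proj₂ p) j ≟ 0) (allPairs N m))
        (cong₂ _+_
          (count-⇔ _ (λ p → Shape? (suc i) j m p ×-dec ¬? (at (proj₁ p) i ≟ 0))
            (λ ((s , z) , w) → Shape-reindex s (Shape.parts₁ s) w , z)
            (λ (s , z) → (Shape-weaken₂ s , z) , Shape.parts₂ s) (allPairs N m))
          (count-⇔ _ (Full? (suc i) (suc j) m) (λ ((s , z) , w) → s , z , w) (λ (s , z , w) → (s , z) , w) (allPairs N m)))

  -- Independence of the ambient length

  Cylindric-cong : ∀ {m n} {p : Vec ℕ m × Vec ℕ m} {p′ : Vec ℕ n × Vec ℕ n} →
    (∀ k → at (proj₁ p) k ≡ at (proj₁ p′) k) → (∀ k → at (proj₂ p) k ≡ at (proj₂ p′) k) →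
    Cylindric c₁ c₂ p → Cylindric c₁ c₂ p′
  Cylindric-cong eq₁ eq₂ (cylindric dv dw d₁ d₂) = cylindric
    (dominates λ k → subst₂ _≤_ (eq₁ _) (eq₁ k) (at-≤ dv k))
    (dominates λ k → subst₂ _≤_ (eq₂ _) (eq₂ k) (at-≤ dw k))
    (dominates λ k → subst₂ _≤_ (eq₂ _) (eq₁ k) (at-≤ d₁ k))
    (dominates λ k → subst₂ _≤_ (eq₁ _) (eq₂ k) (at-≤ d₂ k))

  -- Padding with zeros and truncating are inverse here: `parts₁` and `parts₂` ensure that
  -- truncation to length `n` discards only zeros.
  CP≈F : ∀ {n} → n ≤ N → CP c₁ c₂ n ≈ₛ F n n
  CP≈F {n} n≤N m = cong +_ (trans
    (sym (count-cartesianProduct P? (allVecs n m) (allVecs n m)))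
    (count-bijection P? (Shape? n n m) (allPairs-unique n m) (allPairs-unique N m)
      (λ {(v , w)} p → ∈-allPairs v w (proj₂ (P⁻ v w p))) ∈-allPairs-Shape
      (λ (v , w) → resize N v , resize N w) (λ (v , w) → resize n v , resize n w)
      (λ {(v , w)} p → let cyl , size = P⁻ v w p in
        shape (Cylindric-cong (sym ∘ at-extend v) (sym ∘ at-extend w) cyl)
          (trans (at-extend v n) (at-≥ v ≤-refl)) (trans (at-extend w n) (at-≥ w ≤-refl))
          (trans (cong₂ _+_ (vsum-cong (resize N v) v (at-extend v)) (vsum-cong (resize N w) w (at-extend w))) size))
      (λ {(v , w)} s → Equivalence.to T-≡ (Equivalence.from (T-∧ {isCylindric c₁ c₂ (resize n v) (resize n w)})
        ( isCylindric⁺ (resize n v) (resize n w) (Cylindric-cong (sym ∘ at-restrict₁ s) (sym ∘ at-restrict₂ s) (Shape.cyl s))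
        , ≡⇒≡ᵇ _ _ (trans (cong₂ _+_ (vsum-cong (resize n v) v (at-restrict₁ s))
                                     (vsum-cong (resize n w) w (at-restrict₂ s))) (Shape.size s)))))
      (λ {(v , w)} _ → cong₂ _,_ (restrict-extend v) (restrict-extend w))
      (λ {(v , w)} s → cong₂ _,_
        (at-injective λ k → trans (at-extend (resize n v) k) (at-restrict₁ s k))
        (at-injective λ k → trans (at-extend (resize n w) k) (at-restrict₂ s k)))))
    where
      P : Vec ℕ n × Vec ℕ n → Set
      P (v , w) = (isCylindric c₁ c₂ v w ∧ (vsum v + vsum w ≡ᵇ m)) ≡ true

      P? : Decidable P
      P? (v , w) = (isCylindric c₁ c₂ v w ∧ (vsum v + vsum w ≡ᵇ m)) Bool.≟ true

      P⁻ : ∀ v w → P (v , w) → Cylindric c₁ c₂ (v , w) × vsum v + vsum w ≡ m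
      P⁻ v w eq =
        let t , s = Equivalence.to (T-∧ {isCylindric c₁ c₂ v w}) (Equivalence.from T-≡ eq)
        in isCylindric⁻ v w t , ≡ᵇ⇒≡ _ _ s

      at-extend : (v : Vec ℕ n) → ∀ k → at (resize N v) k ≡ at v k
      at-extend v = at-resize N v (λ N≤k → at-≥ v (≤-trans n≤N N≤k))

      at-restrict₁ : ∀ {p} → Shape n n m p → ∀ k → at (resize n (proj₁ p)) k ≡ at (proj₁ p) k
      at-restrict₁ {v , _} s = at-resize n v (partition-zero (Shape.partition₁ s) n (Shape.parts₁ s))

      at-restrict₂ : ∀ {p} → Shape n n m p → ∀ k → at (resize n (proj₂ p)) k ≡ at (proj₂ p) k
      at-restrict₂ {_ , w} s = at-resize n w (partition-zero (Shape.partition₂ s) n (Shape.parts₂ s))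

      restrict-extend : (v : Vec ℕ n) → resize n (resize N v) ≡ v
      restrict-extend v = at-injective λ k → trans
        (at-resize n (resize N v) (λ n≤j → trans (at-extend v _) (at-≥ v n≤j)) k) (at-extend v k)

-- Elimination for profile (4,0)

private
  :1-_ : ∀ {n} → FPS-Solver.Polynomial n → FPS-Solver.Polynomial n
  :1- x = con (+ 1) :- x
    where open FPS-Solver

-- Removes the first subdiagonal: for `X` = F(i,i), `U` = F(i,i-1), `X′` = F(i-1,i-1), `U′` =
-- F(i-1,i-2) and `Y` = F(i,i-2), the difference of `X′` and `U′` collapses to `C ⊛ X′`.
diagonal-relation : ∀ A B C X U X′ U′ Y → A ⊛ X ≈ₛ U → B ⊛ U ≈ₛ X′ ⊕ Y ⊖ U′ → (𝟙 ⊖ C) ⊛ X′ ≈ₛ U′ →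
                    B ⊛ (A ⊛ X) ≈ₛ C ⊛ X′ ⊕ Y
diagonal-relation A B C X U X′ U′ Y a b c = begin
  B ⊛ (A ⊛ X)             ≈⟨ ⊛-congˡ B a ⟩
  B ⊛ U                   ≈⟨ b ⟩
  X′ ⊕ Y ⊖ U′             ≈⟨ ⊖-cong {X′ ⊕ Y} ≈-refl c ⟨
  X′ ⊕ Y ⊖ (𝟙 ⊖ C) ⊛ X′   ≈⟨ solve 3 (λ C X Y → X :+ Y :- (:1- C) :* X := C :* X :+ Y) ≈-refl C X′ Y ⟩
  C ⊛ X′ ⊕ Y              ∎
  where
    open FPS-Solver
    open import Relation.Binary.Reasoning.Setoid FPS-setoid

-- The letters stand for diagonals: in row n-k+1, `Yₖ` and `Vₖ` have differences 2 and 3; in row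
-- n-k, `Xₖ` and `Uₖ` have differences 0 and 1. `W` is F(n,n-4), `Z` is (1 - q^{2n-1})(1 - q^{2n})
-- F(n,n), and `Qₖ` is q^{2n-6+k}. The factors `E₄`, `E₃`, `E₂` are used up by the relations for
-- `Y₁`, `V₁`, `W` in turn, after which only `Y₂` and `V₂` remain to be expressed by diagonal terms.
eliminate : ∀ Q₀ Q₁ Q₂ Q₃ Q₄ Z X₁ X₂ X₃ U₁ U₂ Y₁ Y₂ Y₃ V₁ V₂ W →
  let E₁ = 𝟙 ⊖ Q₁; E₂ = 𝟙 ⊖ Q₂; E₃ = 𝟙 ⊖ Q₃; E₄ = 𝟙 ⊖ Q₄ in
  Z ≈ₛ Q₄ ⊛ X₁ ⊕ Y₁ → E₃ ⊛ (E₄ ⊛ X₁) ≈ₛ Q₂ ⊛ X₂ ⊕ Y₂ → E₁ ⊛ (E₂ ⊛ X₂) ≈ₛ Q₀ ⊛ X₃ ⊕ Y₃ →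
  E₄ ⊛ X₁ ≈ₛ U₁ → E₂ ⊛ X₂ ≈ₛ U₂ →
  E₄ ⊛ Y₁ ≈ₛ U₁ ⊕ V₁ ⊖ Y₂ → E₂ ⊛ Y₂ ≈ₛ U₂ ⊕ V₂ ⊖ Y₃ → E₃ ⊛ V₁ ≈ₛ Y₂ ⊕ W ⊖ V₂ → E₂ ⊛ W ≈ₛ V₂ →
  E₂ ⊛ E₃ ⊛ E₄ ⊛ Z ≈ₛ
    E₂ ⊛ E₃ ⊛ E₄ ⊛ (𝟙 ⊕ Q₂ ⊕ Q₃ ⊕ Q₄) ⊛ X₁
    ⊖ E₂ ⊛ (Q₂ ⊛ Q₃ ⊕ Q₂ ⊛ Q₂ ⊕ Q₁ ⊛ Q₂) ⊛ X₂ ⊖ Q₀ ⊛ Q₂ ⊛ X₃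
eliminate Q₀ Q₁ Q₂ Q₃ Q₄ Z X₁ X₂ X₃ U₁ U₂ Y₁ Y₂ Y₃ V₁ V₂ W x₁ x₂ x₃ u₁ u₂ y₁ y₂ v₁ w = begin
  E₂ ⊛ E₃ ⊛ E₄ ⊛ Z
    ≈⟨ ⊛-congˡ (E₂ ⊛ E₃ ⊛ E₄) x₁ ⟩
  E₂ ⊛ E₃ ⊛ E₄ ⊛ (Q₄ ⊛ X₁ ⊕ Y₁)
    ≈⟨ solve 5 (λ A E Q X Y → A :* E :* (Q :* X :+ Y) := A :* (E :* Q :* X :+ E :* Y))
         ≈-refl (E₂ ⊛ E₃) E₄ Q₄ X₁ Y₁ ⟩
  E₂ ⊛ E₃ ⊛ (E₄ ⊛ Q₄ ⊛ X₁ ⊕ E₄ ⊛ Y₁)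
    ≈⟨ ⊛-congˡ (E₂ ⊛ E₃) (⊕-cong {E₄ ⊛ Q₄ ⊛ X₁} ≈-refl y₁′) ⟩
  E₂ ⊛ E₃ ⊛ (E₄ ⊛ Q₄ ⊛ X₁ ⊕ (E₄ ⊛ X₁ ⊕ V₁ ⊖ Y₂))
    ≈⟨ solve 7 (λ A B E Q X V Y → A :* B :* (E :* Q :* X :+ (E :* X :+ V :- Y))
         := A :* B :* E :* (con (+ 1) :+ Q) :* X :+ A :* (B :* V) :- A :* B :* Y)
         ≈-refl E₂ E₃ E₄ Q₄ X₁ V₁ Y₂ ⟩
  M ⊕ E₂ ⊛ (E₃ ⊛ V₁) ⊖ E₂ ⊛ E₃ ⊛ Y₂
    ≈⟨ ⊖-cong {g = E₂ ⊛ E₃ ⊛ Y₂} (⊕-cong {M} ≈-refl v₁′) ≈-refl ⟩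
  M ⊕ (E₂ ⊛ Y₂ ⊕ Q₂ ⊛ V₂) ⊖ E₂ ⊛ E₃ ⊛ Y₂
    ≈⟨ solve 5 (λ M Q₂ Q₃ Y V → M :+ ((:1- Q₂) :* Y :+ Q₂ :* V) :- (:1- Q₂) :* (:1- Q₃) :* Y
         := M :+ (:1- Q₂) :* Q₃ :* Y :+ Q₂ :* V) ≈-refl M Q₂ Q₃ Y₂ V₂ ⟩
  M ⊕ E₂ ⊛ Q₃ ⊛ Y₂ ⊕ Q₂ ⊛ V₂
    ≈⟨ ⊕-cong {M ⊕ E₂ ⊛ Q₃ ⊛ Y₂} ≈-refl (⊛-congˡ Q₂ v₂′) ⟩
  M ⊕ E₂ ⊛ Q₃ ⊛ Y₂ ⊕ Q₂ ⊛ (E₂ ⊛ Y₂ ⊖ Q₁ ⊛ E₂ ⊛ X₂ ⊖ Q₀ ⊛ X₃)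
    ≈⟨ solve 9 (λ M E Q₀ Q₁ Q₂ Q₃ Y X₂ X₃ → M :+ E :* Q₃ :* Y :+ Q₂ :* (E :* Y :- Q₁ :* E :* X₂ :- Q₀ :* X₃)
         := M :+ E :* (Q₂ :+ Q₃) :* Y :- E :* Q₁ :* Q₂ :* X₂ :- Q₀ :* Q₂ :* X₃)
         ≈-refl M E₂ Q₀ Q₁ Q₂ Q₃ Y₂ X₂ X₃ ⟩
  M ⊕ E₂ ⊛ (Q₂ ⊕ Q₃) ⊛ Y₂ ⊖ E₂ ⊛ Q₁ ⊛ Q₂ ⊛ X₂ ⊖ Q₀ ⊛ Q₂ ⊛ X₃
    ≈⟨ ⊖-cong {g = Q₀ ⊛ Q₂ ⊛ X₃} (⊖-cong {g = E₂ ⊛ Q₁ ⊛ Q₂ ⊛ X₂}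
         (⊕-cong {M} ≈-refl (⊛-congˡ (E₂ ⊛ (Q₂ ⊕ Q₃)) y₂′)) ≈-refl) ≈-refl ⟩
  M ⊕ E₂ ⊛ (Q₂ ⊕ Q₃) ⊛ (E₃ ⊛ (E₄ ⊛ X₁) ⊖ Q₂ ⊛ X₂) ⊖ E₂ ⊛ Q₁ ⊛ Q₂ ⊛ X₂ ⊖ Q₀ ⊛ Q₂ ⊛ X₃
    ≈⟨ solve 10 (λ E₂ E₃ E₄ Q₁ Q₂ Q₃ Q₄ X₁ X₂ R →
         E₂ :* E₃ :* E₄ :* (con (+ 1) :+ Q₄) :* X₁ :+ E₂ :* (Q₂ :+ Q₃) :* (E₃ :* (E₄ :* X₁) :- Q₂ :* X₂)
           :- E₂ :* Q₁ :* Q₂ :* X₂ :- R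
         := E₂ :* E₃ :* E₄ :* (con (+ 1) :+ Q₂ :+ Q₃ :+ Q₄) :* X₁
           :- E₂ :* (Q₂ :* Q₃ :+ Q₂ :* Q₂ :+ Q₁ :* Q₂) :* X₂ :- R)
         ≈-refl E₂ E₃ E₄ Q₁ Q₂ Q₃ Q₄ X₁ X₂ (Q₀ ⊛ Q₂ ⊛ X₃) ⟩
  E₂ ⊛ E₃ ⊛ E₄ ⊛ (𝟙 ⊕ Q₂ ⊕ Q₃ ⊕ Q₄) ⊛ X₁
    ⊖ E₂ ⊛ (Q₂ ⊛ Q₃ ⊕ Q₂ ⊛ Q₂ ⊕ Q₁ ⊛ Q₂) ⊛ X₂ ⊖ Q₀ ⊛ Q₂ ⊛ X₃ ∎
  where
    open FPS-Solver
    open import Relation.Binary.Reasoning.Setoid FPS-setoid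
    E₁ = 𝟙 ⊖ Q₁
    E₂ = 𝟙 ⊖ Q₂
    E₃ = 𝟙 ⊖ Q₃
    E₄ = 𝟙 ⊖ Q₄
    M  = E₂ ⊛ E₃ ⊛ E₄ ⊛ (𝟙 ⊕ Q₄) ⊛ X₁

    y₁′ : E₄ ⊛ Y₁ ≈ₛ E₄ ⊛ X₁ ⊕ V₁ ⊖ Y₂
    y₁′ = ≈-trans y₁ (⊖-cong {g = Y₂} (⊕-cong {g = V₁} (≈-sym u₁) ≈-refl) ≈-refl)

    y₂′ : Y₂ ≈ₛ E₃ ⊛ (E₄ ⊛ X₁) ⊖ Q₂ ⊛ X₂
    y₂′ = begin
      Y₂                            ≈⟨ solve 2 (λ Y Z → Y := Z :+ Y :- Z) ≈-refl Y₂ (Q₂ ⊛ X₂) ⟩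
      Q₂ ⊛ X₂ ⊕ Y₂ ⊖ Q₂ ⊛ X₂        ≈⟨ ⊖-cong {g = Q₂ ⊛ X₂} x₂ ≈-refl ⟨
      E₃ ⊛ (E₄ ⊛ X₁) ⊖ Q₂ ⊛ X₂      ∎

    -- The extra factor `E₂` is the one in the relation for `W`, so `W` becomes a second `V₂`, and
    -- subtracting `E₂ ⊛ V₂` from it leaves `Q₂ ⊛ V₂`.
    v₁′ : E₂ ⊛ (E₃ ⊛ V₁) ≈ₛ E₂ ⊛ Y₂ ⊕ Q₂ ⊛ V₂
    v₁′ = begin
      E₂ ⊛ (E₃ ⊛ V₁)                ≈⟨ ⊛-congˡ E₂ v₁ ⟩
      E₂ ⊛ (Y₂ ⊕ W ⊖ V₂)            ≈⟨ solve 4 (λ E Y W V → E :* (Y :+ W :- V) := E :* Y :+ E :* W :- E :* V) ≈-refl E₂ Y₂ W V₂ ⟩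
      E₂ ⊛ Y₂ ⊕ E₂ ⊛ W ⊖ E₂ ⊛ V₂    ≈⟨ ⊖-cong {g = E₂ ⊛ V₂} (⊕-cong {E₂ ⊛ Y₂} ≈-refl w) ≈-refl ⟩
      E₂ ⊛ Y₂ ⊕ V₂ ⊖ E₂ ⊛ V₂        ≈⟨ solve 3 (λ Z Q V → Z :+ V :- (:1- Q) :* V := Z :+ Q :* V) ≈-refl (E₂ ⊛ Y₂) Q₂ V₂ ⟩
      E₂ ⊛ Y₂ ⊕ Q₂ ⊛ V₂             ∎

    -- `Y₃` occurs with opposite signs in `y₂` and `x₃`, so adding the two cancels it; this is where
    -- `X₃` enters.
    v₂′ : V₂ ≈ₛ E₂ ⊛ Y₂ ⊖ Q₁ ⊛ E₂ ⊛ X₂ ⊖ Q₀ ⊛ X₃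
    v₂′ = begin
      V₂
        ≈⟨ solve 4 (λ V U Y Z → V := U :+ V :- Y :- U :+ (Z :+ Y) :- Z) ≈-refl V₂ U₂ Y₃ (Q₀ ⊛ X₃) ⟩
      U₂ ⊕ V₂ ⊖ Y₃ ⊖ U₂ ⊕ (Q₀ ⊛ X₃ ⊕ Y₃) ⊖ Q₀ ⊛ X₃
        ≈⟨ ⊖-cong {g = Q₀ ⊛ X₃} (⊕-cong (⊖-cong y₂ u₂) x₃) ≈-refl ⟨
      E₂ ⊛ Y₂ ⊖ E₂ ⊛ X₂ ⊕ E₁ ⊛ (E₂ ⊛ X₂) ⊖ Q₀ ⊛ X₃
        ≈⟨ solve 5 (λ Z E X Q R → Z :- E :* X :+ (:1- Q) :* (E :* X) :- R := Z :- Q :* E :* X :- R)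
             ≈-refl (E₂ ⊛ Y₂) E₂ X₂ Q₁ (Q₀ ⊛ X₃) ⟩
      E₂ ⊛ Y₂ ⊖ Q₁ ⊛ E₂ ⊛ X₂ ⊖ Q₀ ⊛ X₃ ∎

module Profile₄₀ (m : ℕ) where

  open Shapes 4 0 (3 + m)

  -- The second index is shifted by one, with F(i,-1) = 0, so that the cases n = 3 and n > 3 are uniform.
  Fₛ : ℕ → ℕ → FPS
  Fₛ i zero    = 𝟘
  Fₛ i (suc j) = F i j

  private
    1-q^-cong : ∀ {a b} f → a ≡ b → 1-q^ a ⊛ f ≈ₛ 1-q^ b ⊛ f
    1-q^-cong f refl _ = refl

  F-step′ : ∀ i j → suc i ≤ 3 + m → j ≤ i → i ≤ 3 + j →
           1-q^ (suc i + j) ⊛ F (suc i) j ≈ₛ F i j ⊕ Fₛ (suc i) j ⊖ Fₛ i j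
  -- With no part allowed in λ², positivity of λ² is vacuous and both terms of second index -1
  -- vanish.
  F-step′ i zero    i<N _   i≤ k = trans
    (F-corner₁ i<N z≤n (s≤s i≤) z≤n (λ _ _ → tt) k)
    (sym (trans (ℤₚ.+-identityʳ _) (ℤₚ.+-identityʳ _)))
  F-step′ i (suc j) i<N j<i i≤ =
    F-interior i<N (≤-trans j<i (<⇒≤ i<N))
      (subst (suc i ≤_) (+-comm 4 (suc j)) (s≤s i≤))
      (subst (suc j ≤_) (sym (+-identityʳ (suc i))) (m≤n⇒m≤1+n j<i))

  F-step : ∀ a b → a ≤ 2 → b ≤ a →
           1-q^ (suc a + b + (m + m)) ⊛ F (suc a + m) (b + m)
             ≈ₛ F (a + m) (b + m) ⊕ Fₛ (suc a + m) (b + m) ⊖ Fₛ (a + m) (b + m)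
  F-step a b a≤2 b≤a = ≈-trans
    (1-q^-cong (F (suc a + m) (b + m)) (sym (+-interchange (suc a) m b m)))
    (F-step′ (a + m) (b + m) (s≤s (+-monoˡ-≤ m a≤2)) (+-monoˡ-≤ m b≤a)
      (≤-trans (+-monoˡ-≤ m a≤2) (≤-trans (n≤1+n _) (+-monoʳ-≤ 3 (m≤n+m m b)))))

  F-diagonal′ : ∀ i → i ≤ 3 + m → 1-q^ (i + i) ⊛ F i i ≈ₛ Fₛ i i
  -- The convention F(0,-1) = 0 fits, since the factor 1 - q^0 is zero.
  F-diagonal′ zero    _   k = trans
    (solve 1 (λ f → (con (+ 1) :- con (+ 1)) :* f := f :- f) ≈-refl (F 0 0) k) (ℤₚ.+-inverseʳ (F 0 0 k))
    where open FPS-Solver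
  F-diagonal′ (suc i) i<N =
    F-corner₂ i<N i<N (m≤m+n (suc i) 4) (m≤m+n (suc i) 0)
      -- Since `c₂` is 0, each part of λ² is at most the part of λ¹ with the same index.
      (λ {p} cyl w≢0 v≡0 → w≢0 (n≤0⇒n≡0 (≤-trans
        (subst (λ k → at (proj₂ p) k ≤ at (proj₁ p) i) (+-identityʳ i) (at-≤ (Cylindric.dominates₁ cyl) i))
        (≤-reflexive v≡0))))

  F-diagonal : ∀ a → a ≤ 3 → 1-q^ (a + a + (m + m)) ⊛ F (a + m) (a + m) ≈ₛ Fₛ (a + m) (a + m)
  F-diagonal a a≤3 = ≈-trans
    (1-q^-cong (F (a + m) (a + m)) (sym (+-interchange a m a m)))
    (F-diagonal′ (a + m) (+-monoˡ-≤ m a≤3))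

  F-edge′ : ∀ j → 4 + j ≤ 3 + m → 1-q^ (4 + j + j) ⊛ F (4 + j) j ≈ₛ F (3 + j) j
  F-edge′ j j≤ = F-corner₁ j≤ (≤-trans (m≤n+m j 4) j≤) (≤-reflexive (+-comm 4 j))
    (≤-trans (m≤n+m j 4) (m≤m+n (4 + j) 0)) (λ {p} → positive j {p})
    where
      -- λ²_j ≥ λ¹_{j+4}, so a positive part of index `4 + j` in λ¹ forces the `j`-th part of λ² to
      -- be positive.
      positive : ∀ j {p} → Cylindric 4 0 p → at (proj₁ p) (3 + j) ≢ 0 → Positive j (proj₂ p)
      positive zero            _   _   = tt
      positive (suc j) {v , w} cyl v≢0 w≡0 = v≢0 (n≤0⇒n≡0 (≤-trans
        (subst (λ k → at v k ≤ at w j) (+-comm j 4) (at-≤ (Cylindric.dominates₂ cyl) j)) (≤-reflexive w≡0)))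

  -- `m` is fixed by the module and occurs in the ambient length; the separate `j` with `j ≡ m` can
  -- be split into cases.
  F-edge : ∀ j → j ≡ m → 1-q^ (2 + (j + j)) ⊛ Fₛ (3 + j) j ≈ₛ Fₛ (2 + j) j
  F-edge zero    _    = CommutativeRing.zeroʳ FPS-commutativeRing (1-q^ 2)
  F-edge (suc j) refl = ≈-trans
    (1-q^-cong (F (4 + j) j) (cong (λ k → 3 + k) (+-suc j j))) (F-edge′ j ≤-refl)

  F-recurrence : let s = m + m in
    1-q^ (2 + s) ⊛ 1-q^ (3 + s) ⊛ 1-q^ (4 + s) ⊛ (1-q^ (5 + s) ⊛ (1-q^ (6 + s) ⊛ F (3 + m) (3 + m))) ≈ₛ
      1-q^ (2 + s) ⊛ 1-q^ (3 + s) ⊛ 1-q^ (4 + s) ⊛ (𝟙 ⊕ q^ (2 + s) ⊕ q^ (3 + s) ⊕ q^ (4 + s)) ⊛ F (2 + m) (2 + m)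
      ⊖ 1-q^ (2 + s) ⊛ (q^ (2 + s) ⊛ q^ (3 + s) ⊕ q^ (2 + s) ⊛ q^ (2 + s) ⊕ q^ (1 + s) ⊛ q^ (2 + s)) ⊛ F (1 + m) (1 + m)
      ⊖ q^ s ⊛ q^ (2 + s) ⊛ F m m
  F-recurrence =
    eliminate (Q 0) (Q 1) (Q 2) (Q 3) (Q 4)
      (1-q^ (5 + (m + m)) ⊛ (1-q^ (6 + (m + m)) ⊛ F (3 + m) (3 + m)))
      (F (2 + m) (2 + m)) (F (1 + m) (1 + m)) (F m m)
      (F (2 + m) (1 + m)) (F (1 + m) m)
      (F (3 + m) (1 + m)) (F (2 + m) m) (Fₛ (1 + m) m)
      (F (3 + m) m) (Fₛ (2 + m) m) (Fₛ (3 + m) m)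
      (diagonal-relation (1-q^ (6 + (m + m))) (1-q^ (5 + (m + m))) (Q 4)
        (F (3 + m) (3 + m)) (F (3 + m) (2 + m)) (F (2 + m) (2 + m)) (F (2 + m) (1 + m)) (F (3 + m) (1 + m))
        (F-diagonal 3 ≤-refl) (F-step 2 2 ≤-refl ≤-refl) (F-diagonal 2 2≤3))
      (diagonal-relation (1-q^ (4 + (m + m))) (1-q^ (3 + (m + m))) (Q 2)
        (F (2 + m) (2 + m)) (F (2 + m) (1 + m)) (F (1 + m) (1 + m)) (F (1 + m) m) (F (2 + m) m)
        (F-diagonal 2 2≤3) (F-step 1 1 1≤2 ≤-refl) (F-diagonal 1 (s≤s z≤n)))
      (diagonal-relation (1-q^ (2 + (m + m))) (1-q^ (1 + (m + m))) (Q 0)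
        (F (1 + m) (1 + m)) (F (1 + m) m) (F m m) (Fₛ m m) (Fₛ (1 + m) m)
        (F-diagonal 1 (s≤s z≤n)) (F-step 0 0 z≤n ≤-refl) (F-diagonal 0 z≤n))
      (F-diagonal 2 2≤3) (F-diagonal 1 (s≤s z≤n))
      (F-step 2 1 ≤-refl (s≤s z≤n)) (F-step 1 0 1≤2 z≤n) (F-step 2 0 ≤-refl z≤n) (F-edge m refl)
    where
      Q : ℕ → FPS
      Q k = q^ (k + (m + m))
      1≤2 : 1 ≤ 2
      1≤2 = s≤s z≤n
      2≤3 : 2 ≤ 3
      2≤3 = s≤s 1≤2

-- Division and the final form

inv1-q^-cancel : ∀ k .{{_ : NonZero k}} f → inv1-q^ k ⊛ 1-q^ k ⊛ f ≈ₛ f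
inv1-q^-cancel k f = ≈-trans (⊛-cong {g = f} (inv1-q^-inverse k) ≈-refl) (⊛-identityˡ f)

-- Multiplying by all five inverses cancels three factors in the first term, one in the second and
-- none in the third; hence the two, four and five denominators.
divide : ∀ s (X₀ P₁ X₁ P₂ X₂ P₃ X₃ : FPS) →
  1-q^ (2 + s) ⊛ 1-q^ (3 + s) ⊛ 1-q^ (4 + s) ⊛ (1-q^ (5 + s) ⊛ (1-q^ (6 + s) ⊛ X₀)) ≈ₛ
    1-q^ (2 + s) ⊛ 1-q^ (3 + s) ⊛ 1-q^ (4 + s) ⊛ P₁ ⊛ X₁ ⊖ 1-q^ (2 + s) ⊛ P₂ ⊛ X₂ ⊖ P₃ ⊛ X₃ →
  X₀ ≈ₛ P₁ ⊛ inv1-q^ (5 + s) ⊛ inv1-q^ (6 + s) ⊛ X₁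
    ⊖ P₂ ⊛ inv1-q^ (3 + s) ⊛ inv1-q^ (4 + s) ⊛ inv1-q^ (5 + s) ⊛ inv1-q^ (6 + s) ⊛ X₂
    ⊖ P₃ ⊛ inv1-q^ (2 + s) ⊛ inv1-q^ (3 + s) ⊛ inv1-q^ (4 + s) ⊛ inv1-q^ (5 + s) ⊛ inv1-q^ (6 + s) ⊛ X₃
divide s X₀ P₁ X₁ P₂ X₂ P₃ X₃ h = begin
  X₀
    ≈⟨ cancel 2 (cancel 3 (cancel 4 (cancel 5 (inv1-q^-cancel (6 + s) X₀)))) ⟨
  I 2 ⊛ E 2 ⊛ (I 3 ⊛ E 3 ⊛ (I 4 ⊛ E 4 ⊛ (I 5 ⊛ E 5 ⊛ (I 6 ⊛ E 6 ⊛ X₀))))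
    ≈⟨ solve 11 (λ i₂ i₃ i₄ i₅ i₆ e₂ e₃ e₄ e₅ e₆ x →
         i₂ :* e₂ :* (i₃ :* e₃ :* (i₄ :* e₄ :* (i₅ :* e₅ :* (i₆ :* e₆ :* x))))
         := i₂ :* i₃ :* i₄ :* i₅ :* i₆ :* (e₂ :* e₃ :* e₄ :* (e₅ :* (e₆ :* x)))) ≈-refl
         (I 2) (I 3) (I 4) (I 5) (I 6) (E 2) (E 3) (E 4) (E 5) (E 6) X₀ ⟩
  I 2 ⊛ I 3 ⊛ I 4 ⊛ I 5 ⊛ I 6 ⊛ (E 2 ⊛ E 3 ⊛ E 4 ⊛ (E 5 ⊛ (E 6 ⊛ X₀)))
    ≈⟨ ⊛-congˡ (I 2 ⊛ I 3 ⊛ I 4 ⊛ I 5 ⊛ I 6) h ⟩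
  I 2 ⊛ I 3 ⊛ I 4 ⊛ I 5 ⊛ I 6 ⊛ (E 2 ⊛ E 3 ⊛ E 4 ⊛ P₁ ⊛ X₁ ⊖ E 2 ⊛ P₂ ⊛ X₂ ⊖ P₃ ⊛ X₃)
    ≈⟨ solve 14 (λ i₂ i₃ i₄ i₅ i₆ e₂ e₃ e₄ p₁ x₁ p₂ x₂ p₃ x₃ →
         i₂ :* i₃ :* i₄ :* i₅ :* i₆ :* (e₂ :* e₃ :* e₄ :* p₁ :* x₁ :- e₂ :* p₂ :* x₂ :- p₃ :* x₃)
         := i₂ :* e₂ :* (i₃ :* e₃ :* (i₄ :* e₄ :* (p₁ :* i₅ :* i₆ :* x₁)))
            :- i₂ :* e₂ :* (p₂ :* i₃ :* i₄ :* i₅ :* i₆ :* x₂)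
            :- p₃ :* i₂ :* i₃ :* i₄ :* i₅ :* i₆ :* x₃) ≈-refl
         (I 2) (I 3) (I 4) (I 5) (I 6) (E 2) (E 3) (E 4) P₁ X₁ P₂ X₂ P₃ X₃ ⟩
  I 2 ⊛ E 2 ⊛ (I 3 ⊛ E 3 ⊛ (I 4 ⊛ E 4 ⊛ T₁)) ⊖ I 2 ⊛ E 2 ⊛ T₂ ⊖ T₃
    ≈⟨ ⊖-cong {g = T₃} (⊖-cong (cancel 2 (cancel 3 (inv1-q^-cancel (4 + s) T₁))) (inv1-q^-cancel (2 + s) T₂)) ≈-refl ⟩
  T₁ ⊖ T₂ ⊖ T₃ ∎
  where
    open FPS-Solver
    open import Relation.Binary.Reasoning.Setoid FPS-setoid
    I E : ℕ → FPS
    I k = inv1-q^ (k + s)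
    E k = 1-q^ (k + s)
    T₁ = P₁ ⊛ I 5 ⊛ I 6 ⊛ X₁
    T₂ = P₂ ⊛ I 3 ⊛ I 4 ⊛ I 5 ⊛ I 6 ⊛ X₂
    T₃ = P₃ ⊛ I 2 ⊛ I 3 ⊛ I 4 ⊛ I 5 ⊛ I 6 ⊛ X₃
    cancel : ∀ k .{{_ : NonZero (k + s)}} {f g} → f ≈ₛ g → I k ⊛ E k ⊛ f ≈ₛ g
    cancel k {f} {g} p = ≈-trans (⊛-congˡ (I k ⊛ E k) p) (inv1-q^-cancel (k + s) g)

-- `a` and `b` stand for 2n and 4n. Once their equations are matched with `refl`, every truncated
-- difference computes to a numeral plus `m`, `s` or `s + s`.
CP-recurrence : ∀ m {n a b} → n ≡ 3 + m → a ≡ 6 + (m + m) → b ≡ 12 + (m + m + (m + m)) →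
  CP₄₀ n ≈ₛ
    (𝟙 ⊕ q^ (a ∸ 4) ⊕ q^ (a ∸ 3) ⊕ q^ (a ∸ 2))
      ⊛ inv1-q^ (a ∸ 1) ⊛ inv1-q^ a
      ⊛ CP₄₀ (n ∸ 1)
    ⊖ (q^ (b ∸ 7) ⊕ q^ (b ∸ 8) ⊕ q^ (b ∸ 9))
      ⊛ inv1-q^ (a ∸ 3) ⊛ inv1-q^ (a ∸ 2) ⊛ inv1-q^ (a ∸ 1) ⊛ inv1-q^ a
      ⊛ CP₄₀ (n ∸ 2)
    ⊖ q^ (b ∸ 10)
      ⊛ inv1-q^ (a ∸ 4) ⊛ inv1-q^ (a ∸ 3) ⊛ inv1-q^ (a ∸ 2) ⊛ inv1-q^ (a ∸ 1) ⊛ inv1-q^ a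
      ⊛ CP₄₀ (n ∸ 3)
CP-recurrence m refl refl refl = divide s (CP₄₀ (3 + m)) P₁ (CP₄₀ (2 + m)) P₂ (CP₄₀ (1 + m)) P₃ (CP₄₀ m) (begin
  E 2 ⊛ E 3 ⊛ E 4 ⊛ (E 5 ⊛ (E 6 ⊛ CP₄₀ (3 + m)))
    ≈⟨ ⊛-congˡ (E 2 ⊛ E 3 ⊛ E 4) (⊛-congˡ (E 5) (⊛-congˡ (E 6) (CP≈F ≤-refl))) ⟩
  E 2 ⊛ E 3 ⊛ E 4 ⊛ (E 5 ⊛ (E 6 ⊛ F (3 + m) (3 + m)))
    ≈⟨ F-recurrence ⟩
  E 2 ⊛ E 3 ⊛ E 4 ⊛ P₁ ⊛ F (2 + m) (2 + m) ⊖ E 2 ⊛ P₂′ ⊛ F (1 + m) (1 + m) ⊖ P₃′ ⊛ F m m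
    ≈⟨ ⊖-cong (⊖-cong (⊛-congˡ (E 2 ⊛ E 3 ⊛ E 4 ⊛ P₁) (CP≈F (m≤n+m (2 + m) 1)))
         (⊛-cong (⊛-congˡ (E 2) P₂≈) (CP≈F (m≤n+m (1 + m) 2)))) (⊛-cong P₃≈ (CP≈F (m≤n+m m 3))) ⟨
  E 2 ⊛ E 3 ⊛ E 4 ⊛ P₁ ⊛ CP₄₀ (2 + m) ⊖ E 2 ⊛ P₂ ⊛ CP₄₀ (1 + m) ⊖ P₃ ⊛ CP₄₀ m ∎)
  where
    open import Relation.Binary.Reasoning.Setoid FPS-setoid
    open Shapes 4 0 (3 + m) using (F; CP≈F)
    open Profile₄₀ m using (F-recurrence)
    s = m + m
    E : ℕ → FPS
    E k = 1-q^ (k + s)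
    P₁  = 𝟙 ⊕ q^ (2 + s) ⊕ q^ (3 + s) ⊕ q^ (4 + s)
    P₂  = q^ (5 + (s + s)) ⊕ q^ (4 + (s + s)) ⊕ q^ (3 + (s + s))
    P₂′ = q^ (2 + s) ⊛ q^ (3 + s) ⊕ q^ (2 + s) ⊛ q^ (2 + s) ⊕ q^ (1 + s) ⊛ q^ (2 + s)
    P₃  = q^ (2 + (s + s))
    P₃′ = q^ s ⊛ q^ (2 + s)
    q^-split : ∀ a b → q^ (a + b + (s + s)) ≈ₛ q^ (a + s) ⊛ q^ (b + s)
    q^-split a b k = trans (cong (λ e → q^ e k) (sym (+-interchange a s b s))) (q^-+ (a + s) (b + s) k)
    -- With s = 2n - 6, the exponents 4n-7, 4n-8 and 4n-9 are sums of two of s+1, s+2, s+3, as the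
    -- elimination produces them.
    P₂≈ : P₂ ≈ₛ P₂′
    P₂≈ = ⊕-cong (⊕-cong (q^-split 2 3) (q^-split 2 2)) (q^-split 1 2)
    P₃≈ : P₃ ≈ₛ P₃′
    P₃≈ = q^-split 0 2

theorem5p1 : ∀ (n : ℕ) → 3 ≤ n →
    CP₄₀ n ≈ₛ
    (𝟙 ⊕ q^ (2 * n ∸ 4) ⊕ q^ (2 * n ∸ 3) ⊕ q^ (2 * n ∸ 2))
    ⊛ inv1-q^ (2 * n ∸ 1) ⊛ inv1-q^ (2 * n)
    ⊛ CP₄₀ (n ∸ 1)
    ⊖ (q^ (4 * n ∸ 7) ⊕ q^ (4 * n ∸ 8) ⊕ q^ (4 * n ∸ 9))
    ⊛ inv1-q^ (2 * n ∸ 3) ⊛ inv1-q^ (2 * n ∸ 2) ⊛ inv1-q^ (2 * n ∸ 1) ⊛ inv1-q^ (2 * n)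
    ⊛ CP₄₀ (n ∸ 2)
    ⊖ q^ (4 * n ∸ 10)
    ⊛ inv1-q^ (2 * n ∸ 4) ⊛ inv1-q^ (2 * n ∸ 3) ⊛ inv1-q^ (2 * n ∸ 2) ⊛ inv1-q^ (2 * n ∸ 1) ⊛ inv1-q^ (2 * n)
    ⊛ CP₄₀ (n ∸ 3)
theorem5p1 n 3≤n = CP-recurrence m n≡ (trans (cong (2 *_) n≡) (2*n m)) (trans (cong (4 *_) n≡) (4*n m))
  where
    open ℕ-Solver
    m = n ∸ 3
    n≡ : n ≡ 3 + m
    n≡ = sym (m+[n∸m]≡n 3≤n)
    2*n : ∀ m → 2 * (3 + m) ≡ 6 + (m + m)
    2*n = solve 1 (λ m → con 2 :* (con 3 :+ m) := con 6 :+ (m :+ m)) refl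
    4*n : ∀ m → 4 * (3 + m) ≡ 12 + (m + m + (m + m))
    4*n = solve 1 (λ m → con 4 :* (con 3 :+ m) := con 12 :+ (m :+ m :+ (m :+ m))) refl
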